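{- There do not exist three finite simple connected graphs $G_1, G_2, G_3$ that are pairwise nonisomorphic and whose $P_3$-graphs $P_3(G_1), P_3(G_2), P_3(G_3)$ are all isomorphic to one another and connected.
   Context: All graphs are finite, simple and undirected. For a positive integer $k$, $P_k$ denotes a path on $k$ vertices and $C_k$ a cycle on $k$ vertices. For a graph $G$, let $\pi_k(G)$ be the set of all subgraphs of $G$ that are paths $P_k$. The path graph $P_k(G)$ is the graph with vertex set $\pi_k(G)$ in which two distinct members of $\pi_k(G)$ are adjacent if and only if their union (as subgraphs of $G$) is a path $P_{k+1}$ or a cycle $C_k$. In particular $P_3(G)$ has as vertices the paths on three vertices in $G$. -}

module Defs where

open import Data.Nat using (ℕ)
open import Data.Fin using (Fin; toℕ; _<_)
open import Data.Bool using (Bool; true; false; T)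
open import Data.Product using (Σ; ∃; _×_; _,_)
open import Data.Sum using (_⊎_)
open import Relation.Binary.PropositionalEquality using (_≡_; _≢_)
open import Relation.Binary.Construct.Closure.ReflexiveTransitive using (Star)
open import Function.Bundles using (_⇔_; _↔_; Inverse)

record Graph : Set where
  field
    n      : ℕ
    adj    : Fin n → Fin n → Bool
    sym    : ∀ i j → adj i j ≡ adj j i
    irrefl : ∀ i → adj i i ≡ false

record RawGraph : Set₁ where
  field
    V : Set
    E : V → V → Set

toRaw : Graph → RawGraph
toRaw G = record { V = Fin (Graph.n G) ; E = λ i j → T (Graph.adj G i j) }

Iso : RawGraph → RawGraph → Set
Iso G H = Σ (RawGraph.V G ↔ RawGraph.V H) λ f →
  ∀ x y → RawGraph.E G x y ⇔ RawGraph.E H (Inverse.to f x) (Inverse.to f y)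

Connected : RawGraph → Set
Connected G = RawGraph.V G × (∀ x y → Star (RawGraph.E G) x y)

-- unordered edge {x,y}, as a membership predicate on ordered pairs (u,v)
UEdge : {V : Set} → V → V → V → V → Set
UEdge x y u v = (u ≡ x × v ≡ y) ⊎ (u ≡ y × v ≡ x)

module _ (G : Graph) where
  open Graph G

  -- A P3 subgraph of G: the path a - b - c.  As a subgraph it is determined
  -- by its middle vertex b and the unordered pair {a,c}; we normalise by a < c.
  record P3Sub : Set where
    constructor p3
    field
      a b c : Fin n
      ab    : T (adj a b)
      bc    : T (adj b c)
      a<c   : a < c

  VSet : P3Sub → Fin n → Set
  VSet (p3 a b c _ _ _) u = u ≡ a ⊎ u ≡ b ⊎ u ≡ c

  ESet : P3Sub → Fin n → Fin n → Set
  ESet (p3 a b c _ _ _) u v = UEdge a b u v ⊎ UEdge b c u v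

  IsP4 : (Fin n → Set) → (Fin n → Fin n → Set) → Set
  IsP4 VS ES = Σ (Fin n) λ v0 → Σ (Fin n) λ v1 → Σ (Fin n) λ v2 → Σ (Fin n) λ v3 →
    (v0 ≢ v1 × v0 ≢ v2 × v0 ≢ v3 × v1 ≢ v2 × v1 ≢ v3 × v2 ≢ v3) ×
    (∀ u → VS u ⇔ (u ≡ v0 ⊎ u ≡ v1 ⊎ u ≡ v2 ⊎ u ≡ v3)) ×
    (∀ u v → ES u v ⇔ (UEdge v0 v1 u v ⊎ UEdge v1 v2 u v ⊎ UEdge v2 v3 u v))

  IsC3 : (Fin n → Set) → (Fin n → Fin n → Set) → Set
  IsC3 VS ES = Σ (Fin n) λ v0 → Σ (Fin n) λ v1 → Σ (Fin n) λ v2 →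
    (v0 ≢ v1 × v0 ≢ v2 × v1 ≢ v2) ×
    (∀ u → VS u ⇔ (u ≡ v0 ⊎ u ≡ v1 ⊎ u ≡ v2)) ×
    (∀ u v → ES u v ⇔ (UEdge v0 v1 u v ⊎ UEdge v1 v2 u v ⊎ UEdge v2 v0 u v))

  P3Adj : P3Sub → P3Sub → Set
  P3Adj p q = p ≢ q × (IsP4 VU EU ⊎ IsC3 VU EU)
    where
    VU : Fin n → Set
    VU u = VSet p u ⊎ VSet q u
    EU : Fin n → Fin n → Set
    EU u v = ESet p u v ⊎ ESet q u v

P3Graph : Graph → RawGraph
P3Graph G = record { V = P3Sub G ; E = P3Adj G }

{-# OPTIONS --safe #-}
-- Fix H and three ways of viewing it as the P₃-graph of G₁, G₂, G₃. For a dart b → c of a root let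
-- D b c be the set of paths centred at b that use it. Say that two roots agree at an edge when they
-- have the same sets D b c and D c b there. Agreement at one edge spreads over the whole graph, up
-- to exchanging vertices of H with equal neighbourhoods, and yields an isomorphism of the roots. So
-- it suffices to find two of the three roots that agree somewhere, if necessary after composing one
-- of them with an automorphism of H.
--
-- If some root has an edge bc between two vertices of degree at least three, then D b c and D c b
-- span a complete bipartite graph containing a 4-cycle. A 4-cycle of H arises either like this or
-- from a 4-cycle of the root. Hence either another root agrees at bc, or in both of the others this
-- 4-cycle comes from a 4-cycle, and then the other two agree at an edge of it.
--
-- Otherwise every vertex q of H with three neighbours is centred, in each root, at a vertex of
-- degree two, and each root divides the neighbours of q into two groups. Of three such divisions
-- two coincide up to twins, so two roots agree.
--
-- If H has no vertex of degree three, then any two roots of maximum degree at most two agree, and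
-- any two other roots agree up to the antipodal map of a hexagon.
module Submission where

open import Defs
open import Data.Bool using (Bool; true; false; T; _xor_)
open import Data.Bool.Properties using (T?; T-irrelevant; not-injective; ¬-not)
import Data.Bool.Properties as Bool
open import Data.Empty using (⊥; ⊥-elim)
open import Data.Fin using (Fin; zero; suc)
open import Data.Fin.Patterns using (0F; 1F; 2F; 3F; 4F; 5F)
open import Data.Fin.Properties using (_≟_; all?; any?; <-cmp; <-irrelevant; <-irrefl; <-asym)
open import Data.Nat using (zero; suc)
open import Data.Product using (Σ; ∃; _×_; _,_; proj₁; proj₂)
open import Data.Sum using (_⊎_; inj₁; inj₂; [_,_]′; swap; map)
open import Data.Vec.Base using (Vec; []; _∷_; lookup)
open import Data.Vec.Relation.Unary.All using ([]; _∷_)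
open import Data.Vec.Relation.Unary.AllPairs using ([]; _∷_)
open import Data.Vec.Relation.Unary.Unique.Propositional using (Unique)
open import Data.Vec.Relation.Unary.Unique.Propositional.Properties using (lookup-injective)
open import Function.Base using (_∘_; id)
open import Function.Bundles using (_⇔_; _↔_; Inverse; Equivalence; mk⇔; mk↔ₛ′)
open import Function.Construct.Identity using (↔-id)
open import Relation.Binary.Construct.Closure.ReflexiveTransitive using (Star; ε; _◅_)
open import Relation.Binary.Definitions using (tri<; tri≈; tri>)
open import Relation.Binary.PropositionalEquality
  using (_≡_; _≢_; refl; sym; trans; cong; cong₂; subst; ≢-sym)
open import Relation.Nullary using (¬_; Dec; yes; no; does)
open import Relation.Nullary.Decidable using (_×-dec_; ¬?; map′; decidable-stable; from-yes)

open RawGraph using (V; E)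

-- Vertices, adjacency and equality of predicates.

Vertex : Graph → Set
Vertex G = Fin (Graph.n G)

Adj : (G : Graph) → Vertex G → Vertex G → Set
Adj G u v = T (Graph.adj G u v)

adj-sym : ∀ G {u v} → Adj G u v → Adj G v u
adj-sym G {u} {v} = subst T (Graph.sym G u v)

adj⇒≢ : ∀ G {u v} → Adj G u v → u ≢ v
adj⇒≢ G {u} uv refl = subst T (Graph.irrefl G u) uv

infix 4 _≐_
_≐_ : {A : Set} → (A → Set) → (A → Set) → Set
X ≐ Y = ∀ h → X h ⇔ Y h

module _ {A : Set} where
  ≐-refl : {X : A → Set} → X ≐ X
  ≐-refl h = mk⇔ id id

  ≐-sym : {X Y : A → Set} → X ≐ Y → Y ≐ X
  ≐-sym e h = mk⇔ (Equivalence.from (e h)) (Equivalence.to (e h))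

  ≐-trans : {X Y Z : A → Set} → X ≐ Y → Y ≐ Z → X ≐ Z
  ≐-trans e f h = mk⇔ (Equivalence.to (f h) ∘ Equivalence.to (e h))
                      (Equivalence.from (e h) ∘ Equivalence.from (f h))

open Equivalence using (to; from)

-- Roots: a graph H viewed as the P₃-graph of G.

-- An identification of H with the P₃-graph of G: `P a b c h` says that h
-- corresponds to the path a - b - c.
record Root (H : RawGraph) (G : Graph) : Set₁ where
  field
    P      : Vertex G → Vertex G → Vertex G → V H → Set
    flip   : ∀ {a b c h} → P a b c h → P c b a h
    P⇒adj  : ∀ {a b c h} → P a b c h → Adj G a b
    P⇒≢    : ∀ {a b c h} → P a b c h → a ≢ c
    ends   : ∀ {a b c a′ b′ c′ h} → P a b c h → P a′ b′ c′ h →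
             b ≡ b′ × ((a ≡ a′ × c ≡ c′) ⊎ (a ≡ c′ × c ≡ a′))
    path   : ∀ {a b c} → Adj G a b → Adj G b c → a ≢ c → ∃ (P a b c)
    unique : ∀ {a b c h k} → P a b c h → P a b c k → h ≡ k
    view   : ∀ h → ∃ λ a → ∃ λ b → ∃ λ c → P a b c h
    E⇒P    : ∀ {h k} → E H h k →
             ∃ λ a → ∃ λ b → ∃ λ c → ∃ λ d → P a b c h × P b c d k
    P⇒E    : ∀ {a b c d h k} → P a b c h → P b c d k → E H h k

module RootProperties {H : RawGraph} {G : Graph} (R : Root H G) where
  open Root R public

  infix 4 _~_
  _~_ : Vertex G → Vertex G → Set
  _~_ = Adj G

  -- The dart b → c as the set of paths centred at b that use it: H is the union, over the edges bc
  -- of G, of the complete bipartite graphs between D b c and D c b.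
  D : Vertex G → Vertex G → V H → Set
  D b c h = ∃ λ a → P a b c h

  P⇒adjʳ : ∀ {a b c h} → P a b c h → b ~ c
  P⇒adjʳ p = adj-sym G (P⇒adj (flip p))

  P⇒D : ∀ {a b c h} → P a b c h → D b c h
  P⇒D p = _ , p

  P⇒Dˡ : ∀ {a b c h} → P a b c h → D b a h
  P⇒Dˡ p = _ , flip p

  D⇒adj : ∀ {b c h} → D b c h → b ~ c
  D⇒adj (_ , p) = P⇒adjʳ p

  center-unique : ∀ {b c b′ c′ h} → D b c h → D b′ c′ h → b ≡ b′
  center-unique (_ , p) (_ , p′) = proj₁ (ends p p′)

  end-cases : ∀ {a b c b′ e h} → P a b c h → D b′ e h → e ≡ a ⊎ e ≡ c
  end-cases p (_ , p′) with proj₂ (ends p p′)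
  ... | inj₁ (_ , c≡e) = inj₂ (sym c≡e)
  ... | inj₂ (a≡e , _) = inj₁ (sym a≡e)

  other-end : ∀ {a b c e h} → P a b c h → P a b e h → c ≡ e
  other-end p p′ with proj₂ (ends p p′)
  ... | inj₁ (_ , c≡e)   = c≡e
  ... | inj₂ (a≡e , c≡a) = trans c≡a a≡e

  join : ∀ {b c b′ e h} → D b c h → D b′ e h → c ≢ e → P c b e h
  join (a , p) d c≢e with center-unique (a , p) d | end-cases p d
  ... | refl | inj₁ refl = flip p
  ... | refl | inj₂ e≡c  = ⊥-elim (c≢e (sym e≡c))

  E⇒D : ∀ {h k} → E H h k → ∃ λ b → ∃ λ c → D b c h × D c b k
  E⇒D e = let (_ , b , c , _ , p , q) = E⇒P e in b , c , P⇒D p , P⇒Dˡ q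

  D⇒E : ∀ {b c h k} → D b c h → D c b k → E H h k
  D⇒E (_ , p) (_ , q) = P⇒E p (flip q)

  E-sym : ∀ {h k} → E H h k → E H k h
  E-sym e = let (_ , _ , d , d′) = E⇒D e in D⇒E d′ d

  E⇒≢ : ∀ {h k} → E H h k → h ≢ k
  E⇒≢ e refl = let (_ , _ , d , d′) = E⇒D e in adj⇒≢ G (D⇒adj d) (center-unique d d′)

  neighbour : ∀ {a b c h k} → P a b c h → E H h k → D a b k ⊎ D c b k
  neighbour p e with E⇒D e
  ... | b′ , e′ , d , d′ with center-unique (P⇒D p) d | end-cases p d
  ... | refl | inj₁ refl = inj₁ d′
  ... | refl | inj₂ refl = inj₂ d′

  neighbour⇔ : ∀ {a b c h} → P a b c h → E H h ≐ (λ k → D a b k ⊎ D c b k)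
  neighbour⇔ p k = mk⇔ (neighbour p) [ D⇒E (P⇒Dˡ p) , D⇒E (P⇒D p) ]′

  -- Otherwise k would be centred at the far ends of both h and h′; these ends, and hence the two
  -- paths, would coincide.
  common-neighbour : ∀ {b c h h′ k} → D b c h → D b c h′ → h ≢ h′ →
                     E H h k → E H h′ k → D c b k
  common-neighbour (a , p) (a′ , p′) h≢h′ e e′ with neighbour p e | neighbour p′ e′
  ... | inj₂ d | _       = d
  ... | inj₁ d | inj₂ d′ = d′
  ... | inj₁ d | inj₁ d′ with center-unique d d′
  ... | refl = ⊥-elim (h≢h′ (unique p p′))

  module _ {b c h} (d : D b c h) where
    D? : ∀ b′ c′ → Dec (D b′ c′ h)
    D? b′ c′ with b′ ≟ b | c′ ≟ c | c′ ≟ proj₁ d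
    ... | no b′≢b  | _        | _        = no (λ d′ → b′≢b (center-unique d′ d))
    ... | yes refl | yes refl | _        = yes d
    ... | yes refl | no _     | yes refl = yes (P⇒Dˡ (proj₂ d))
    ... | yes refl | no c′≢c  | no c′≢a  = no λ d′ → [ c′≢a , c′≢c ]′ (end-cases (proj₂ d) d′)

  D-dec : ∀ b c h → Dec (D b c h)
  D-dec b c h = let (_ , _ , _ , p) = view h in D? (P⇒D p) b c

  infix 4 _≟V_
  _≟V_ : (h k : V H) → Dec (h ≡ k)
  h ≟V k with view h
  ... | a , b , c , p with D-dec b a k | D-dec b c k
  ... | yes d | yes d′ = yes (unique p (join d d′ (P⇒≢ p)))
  ... | yes _ | no ¬d′ = no λ { refl → ¬d′ (P⇒D p) }
  ... | no ¬d | _      = no λ { refl → ¬d (P⇒Dˡ p) }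

  -- In the 4-cycle h k h′ k′ of H, both h and h′ are centred at ends of the path k. If it is the
  -- same end, the four paths lie on the two darts of one edge; if the ends are x and y, then k′
  -- closes a 4-cycle c x a y of the root.
  square : ∀ {h h′ k k′} → h ≢ h′ → k ≢ k′ →
           E H h k → E H h k′ → E H h′ k → E H h′ k′ →
           (∃ λ b → ∃ λ c → D b c h × D b c h′ × D c b k × D c b k′) ⊎
           (∃ λ x → ∃ λ y → ∃ λ c → ∃ λ a →
             P c x a h × P c y a h′ × P x c y k × P x a y k′)
  square {h} {h′} {k} {k′} h≢h′ k≢k′ hk hk′ h′k h′k′ with view k
  ... | x , c , y , pk = by (neighbour pk (E-sym hk)) (neighbour pk (E-sym h′k))
    where
    across : ∀ {x y} → P x c y k → D x c h → D y c h′ →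
             ∃ λ a → P c x a h × P c y a h′ × P x a y k′
    across pk d d′ with E⇒D hk′ | E⇒D h′k′
    ... | x₁ , a , e , e′ | y₁ , a′ , f , f′
      with center-unique e d | center-unique f d′ | center-unique e′ f′
    ... | refl | refl | refl = a , join d e c≢a , join d′ f c≢a , pk′
      where
      pk′ = join e′ f′ (P⇒≢ pk)
      c≢a : c ≢ a
      c≢a refl = k≢k′ (unique pk pk′)

    by : D x c h ⊎ D y c h → D x c h′ ⊎ D y c h′ → _
    by (inj₁ d) (inj₁ d′) = inj₁ (x , c , d , d′ , P⇒Dˡ pk , common-neighbour d d′ h≢h′ hk′ h′k′)
    by (inj₂ d) (inj₂ d′) = inj₁ (y , c , d , d′ , P⇒D pk , common-neighbour d d′ h≢h′ hk′ h′k′)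
    by (inj₁ d) (inj₂ d′) = let (a , p , p′ , q) = across pk d d′
                            in inj₂ (x , y , c , a , p , p′ , pk , q)
    by (inj₂ d) (inj₁ d′) = let (a , p , p′ , q) = across (flip pk) d d′
                            in inj₂ (y , x , c , a , p , p′ , flip pk , q)

-- Recomposing a root with an automorphism of H; twins.

module _ {H : RawGraph} {G : Graph} (R : Root H G) (τ : V H → V H)
         (τ-invol : ∀ h → τ (τ h) ≡ h) (τ-E : ∀ {h k} → E H h k → E H (τ h) (τ k)) where
  open Root R

  -- The automorphisms applied below are transpositions of twins and the antipodal map of a hexagon,
  -- so τ is taken to be its own inverse.
  relabel : Root H G
  relabel = record
    { P      = λ a b c h → P a b c (τ h)
    ; flip   = flip
    ; P⇒adj  = P⇒adj
    ; P⇒≢    = P⇒≢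
    ; ends   = ends
    ; path   = λ ab bc a≢c → let (h , p) = path ab bc a≢c
                             in τ h , subst (P _ _ _) (sym (τ-invol h)) p
    ; unique = λ {_} {_} {_} {h} {k} p q →
                 trans (sym (τ-invol h)) (trans (cong τ (unique p q)) (τ-invol k))
    ; view   = λ h → view (τ h)
    ; E⇒P    = λ e → E⇒P (τ-E e)
    ; P⇒E    = λ {_} {_} {_} {_} {h} {k} p q →
                 subst (λ z → E H z k) (τ-invol h)
                   (subst (E H (τ (τ h))) (τ-invol k) (τ-E (P⇒E p q)))
    }

Twins : (H : RawGraph) → V H → V H → Set
Twins H s t = E H s ≐ E H t

module Transposition {H : RawGraph} (_≟V_ : (h k : V H) → Dec (h ≡ k))
                     (E-sym : ∀ {h k} → E H h k → E H k h)
                     {s t : V H} (s≈t : Twins H s t) where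
  transpose : V H → V H
  transpose h with h ≟V s | h ≟V t
  ... | yes _ | _     = t
  ... | no _  | yes _ = s
  ... | no _  | no _  = h

  transpose-s : transpose s ≡ t
  transpose-s with s ≟V s | s ≟V t
  ... | yes _ | _ = refl
  ... | no s≢s | _ = ⊥-elim (s≢s refl)

  transpose-t : transpose t ≡ s
  transpose-t with t ≟V s | t ≟V t
  ... | yes t≡s | _     = t≡s
  ... | no _    | yes _ = refl
  ... | no _    | no t≢t = ⊥-elim (t≢t refl)

  transpose-other : ∀ {h} → h ≢ s → h ≢ t → transpose h ≡ h
  transpose-other {h} h≢s h≢t with h ≟V s | h ≟V t
  ... | yes h≡s | _       = ⊥-elim (h≢s h≡s)
  ... | no _    | yes h≡t = ⊥-elim (h≢t h≡t)
  ... | no _    | no _    = refl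

  transpose-cases : ∀ h → (h ≡ s × transpose h ≡ t) ⊎ (h ≡ t × transpose h ≡ s) ⊎
                          (h ≢ s × h ≢ t × transpose h ≡ h)
  transpose-cases h with h ≟V s | h ≟V t
  ... | yes h≡s | _       = inj₁ (h≡s , refl)
  ... | no _    | yes h≡t = inj₂ (inj₁ (h≡t , refl))
  ... | no h≢s  | no h≢t  = inj₂ (inj₂ (h≢s , h≢t , refl))

  transpose-invol : ∀ h → transpose (transpose h) ≡ h
  transpose-invol h with transpose-cases h
  ... | inj₁ (refl , e)              = trans (cong transpose e) transpose-t
  ... | inj₂ (inj₁ (refl , e))       = trans (cong transpose e) transpose-s
  ... | inj₂ (inj₂ (_ , _ , e))      = trans (cong transpose e) e

  transpose-twin : ∀ h → Twins H h (transpose h)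
  transpose-twin h with transpose-cases h
  ... | inj₁ (refl , e)         rewrite e = s≈t
  ... | inj₂ (inj₁ (refl , e))  rewrite e = ≐-sym s≈t
  ... | inj₂ (inj₂ (_ , _ , e)) rewrite e = ≐-refl

  transpose-E : ∀ {h k} → E H h k → E H (transpose h) (transpose k)
  transpose-E {h} {k} e =
    E-sym (to (transpose-twin k _) (E-sym (to (transpose-twin h _) e)))

module TwinSwap {H : RawGraph} {G : Graph} (R : Root H G) {s t : V H} (s≈t : Twins H s t) where
  open RootProperties R
  open Transposition {H} _≟V_ E-sym s≈t public

  swapped : Root H G
  swapped = relabel R transpose transpose-invol transpose-E

  module S = RootProperties swapped

  D-stable : ∀ {b c} → (D b c s → D b c t) → (D b c t → D b c s) → S.D b c ≐ D b c
  D-stable {b} {c} st ts h with transpose-cases h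
  ... | inj₁ (refl , e)         rewrite e = mk⇔ ts st
  ... | inj₂ (inj₁ (refl , e))  rewrite e = mk⇔ st ts
  ... | inj₂ (inj₂ (_ , _ , e)) rewrite e = mk⇔ id id

-- P₃-graphs in the given encoding are roots.

module P3Root (G : Graph) where
  open P3Sub

  -- A path is read in either direction, which absorbs the normalisation a < c.
  record IsPath (x y z : Vertex G) (h : P3Sub G) : Set where
    constructor _,_
    field
      centre : b h ≡ y
      sides  : (a h ≡ x × c h ≡ z) ⊎ (a h ≡ z × c h ≡ x)

  VSet⇔ : ∀ {x y z h} → IsPath x y z h → ∀ u → VSet G h u ⇔ (u ≡ x ⊎ u ≡ y ⊎ u ≡ z)
  VSet⇔ (refl , inj₁ (refl , refl)) u = mk⇔ id id
  VSet⇔ (refl , inj₂ (refl , refl)) u = mk⇔ reverse reverse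
    where
    reverse : ∀ {A B C : Set} → A ⊎ B ⊎ C → C ⊎ B ⊎ A
    reverse (inj₁ x)        = inj₂ (inj₂ x)
    reverse (inj₂ (inj₁ y)) = inj₂ (inj₁ y)
    reverse (inj₂ (inj₂ z)) = inj₁ z

  ESet⇔ : ∀ {x y z h} → IsPath x y z h → ∀ u v → ESet G h u v ⇔ (UEdge x y u v ⊎ UEdge y z u v)
  ESet⇔ (refl , inj₁ (refl , refl)) u v = mk⇔ id id
  ESet⇔ (refl , inj₂ (refl , refl)) u v =
    mk⇔ (swap ∘ map swap swap) (swap ∘ map swap swap)

  a≢c : ∀ (h : P3Sub G) → a h ≢ c h
  a≢c h e = <-irrefl e (a<c h)

  -- Proofs of adjacency and order are unique, and opposite readings would order the same two ends
  -- both ways.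
  same-path : ∀ {x y z h k} → IsPath x y z h → IsPath x y z k → h ≡ k
  same-path {h = p3 _ _ _ ab bc lt} {p3 _ _ _ ab′ bc′ lt′}
            (refl , inj₁ (refl , refl)) (refl , inj₁ (refl , refl))
    rewrite T-irrelevant ab ab′ | T-irrelevant bc bc′ | <-irrelevant lt lt′ = refl
  same-path {h = p3 _ _ _ ab bc lt} {p3 _ _ _ ab′ bc′ lt′}
            (refl , inj₂ (refl , refl)) (refl , inj₂ (refl , refl))
    rewrite T-irrelevant ab ab′ | T-irrelevant bc bc′ | <-irrelevant lt lt′ = refl
  same-path {h = p3 _ _ _ _ _ lt} {p3 _ _ _ _ _ lt′}
            (refl , inj₁ (refl , refl)) (refl , inj₂ (refl , refl)) = ⊥-elim (<-asym lt lt′)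
  same-path {h = p3 _ _ _ _ _ lt} {p3 _ _ _ _ _ lt′}
            (refl , inj₂ (refl , refl)) (refl , inj₁ (refl , refl)) = ⊥-elim (<-asym lt lt′)

  -- The edges of P₄ on v₀ v₁ v₂ v₃, and those of C₃ when v₃ is v₀.
  Walk : (v₀ v₁ v₂ v₃ u v : Vertex G) → Set
  Walk v₀ v₁ v₂ v₃ u v = UEdge v₀ v₁ u v ⊎ UEdge v₁ v₂ u v ⊎ UEdge v₂ v₃ u v

  reverse-walk : ∀ {v₀ v₁ v₂ v₃ u v} → Walk v₀ v₁ v₂ v₃ u v → Walk v₃ v₂ v₁ v₀ u v
  reverse-walk (inj₁ e)        = inj₂ (inj₂ (swap e))
  reverse-walk (inj₂ (inj₁ e)) = inj₂ (inj₁ (swap e))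
  reverse-walk (inj₂ (inj₂ e)) = inj₁ (swap e)

  at-v₁ : ∀ {v₀ v₁ v₂ v₃ v} → v₁ ≢ v₀ → v₁ ≢ v₂ → v₁ ≢ v₃ →
          Walk v₀ v₁ v₂ v₃ v₁ v → v ≡ v₀ ⊎ v ≡ v₂
  at-v₁ n0 n2 n3 (inj₁ (inj₁ (e , _)))        = ⊥-elim (n0 e)
  at-v₁ n0 n2 n3 (inj₁ (inj₂ (_ , e)))        = inj₁ e
  at-v₁ n0 n2 n3 (inj₂ (inj₁ (inj₁ (_ , e)))) = inj₂ e
  at-v₁ n0 n2 n3 (inj₂ (inj₁ (inj₂ (e , _)))) = ⊥-elim (n2 e)
  at-v₁ n0 n2 n3 (inj₂ (inj₂ (inj₁ (e , _)))) = ⊥-elim (n2 e)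
  at-v₁ n0 n2 n3 (inj₂ (inj₂ (inj₂ (e , _)))) = ⊥-elim (n3 e)

  at-v₀ : ∀ {v₀ v₁ v₂ v₃ v} → v₀ ≢ v₁ → v₀ ≢ v₂ →
          Walk v₀ v₁ v₂ v₃ v₀ v → v ≡ v₁ ⊎ (v₀ ≡ v₃ × v ≡ v₂)
  at-v₀ n1 n2 (inj₁ (inj₁ (_ , e)))         = inj₁ e
  at-v₀ n1 n2 (inj₁ (inj₂ (e , _)))         = ⊥-elim (n1 e)
  at-v₀ n1 n2 (inj₂ (inj₁ (inj₁ (e , _))))  = ⊥-elim (n1 e)
  at-v₀ n1 n2 (inj₂ (inj₁ (inj₂ (e , _))))  = ⊥-elim (n2 e)
  at-v₀ n1 n2 (inj₂ (inj₂ (inj₁ (e , _))))  = ⊥-elim (n2 e)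
  at-v₀ n1 n2 (inj₂ (inj₂ (inj₂ (e , e′)))) = inj₂ (e , e′)

  walk-vertex : ∀ {v₀ v₁ v₂ v₃ u v} → Walk v₀ v₁ v₂ v₃ u v →
                u ≡ v₀ ⊎ u ≡ v₁ ⊎ u ≡ v₂ ⊎ u ≡ v₃
  walk-vertex (inj₁ (inj₁ (e , _)))        = inj₁ e
  walk-vertex (inj₁ (inj₂ (e , _)))        = inj₂ (inj₁ e)
  walk-vertex (inj₂ (inj₁ (inj₁ (e , _)))) = inj₂ (inj₁ e)
  walk-vertex (inj₂ (inj₁ (inj₂ (e , _)))) = inj₂ (inj₂ (inj₁ e))
  walk-vertex (inj₂ (inj₂ (inj₁ (e , _)))) = inj₂ (inj₂ (inj₁ e))
  walk-vertex (inj₂ (inj₂ (inj₂ (e , _)))) = inj₂ (inj₂ (inj₂ e))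

  between : ∀ {x y z} h → b h ≡ y → a h ≡ x ⊎ a h ≡ z → c h ≡ x ⊎ c h ≡ z → IsPath x y z h
  between h e (inj₁ p) (inj₁ q) = ⊥-elim (a≢c h (trans p (sym q)))
  between h e (inj₁ p) (inj₂ q) = e , inj₁ (p , q)
  between h e (inj₂ p) (inj₁ q) = e , inj₂ (p , q)
  between h e (inj₂ p) (inj₂ q) = ⊥-elim (a≢c h (trans p (sym q)))

  -- The centre of h has two different neighbours on the walk, so it is v₁ or v₂, or v₀ if the walk
  -- is closed. Leaving v₀ ≡ v₃ open treats P₄ and C₃ together.
  within-walk : ∀ {v₀ v₁ v₂ v₃} h → v₀ ≢ v₁ → v₀ ≢ v₂ → v₁ ≢ v₂ → v₁ ≢ v₃ → v₂ ≢ v₃ →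
                (∀ {u v} → ESet G h u v → Walk v₀ v₁ v₂ v₃ u v) →
                IsPath v₀ v₁ v₂ h ⊎ IsPath v₁ v₂ v₃ h ⊎ (v₀ ≡ v₃ × IsPath v₂ v₀ v₁ h)
  within-walk {v₀} {v₁} {v₂} {v₃} h n01 n02 n12 n13 n23 es = at (walk-vertex to-a)
    where
    to-a = es (inj₁ (inj₂ (refl , refl)))
    to-c = es (inj₂ (inj₁ (refl , refl)))

    from-v₀ : ∀ {w₀ w₁ w₂ w₃} → w₀ ≢ w₁ → w₀ ≢ w₂ → b h ≡ w₀ →
              Walk w₀ w₁ w₂ w₃ (b h) (a h) → Walk w₀ w₁ w₂ w₃ (b h) (c h) →
              w₀ ≡ w₃ × IsPath w₂ w₀ w₁ h
    from-v₀ n1 n2 refl to-a to-c with at-v₀ n1 n2 to-a | at-v₀ n1 n2 to-c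
    ... | inj₁ p       | inj₁ q       = ⊥-elim (a≢c h (trans p (sym q)))
    ... | inj₁ p       | inj₂ (e , q) = e , refl , inj₂ (p , q)
    ... | inj₂ (e , p) | inj₁ q       = e , refl , inj₁ (p , q)
    ... | inj₂ (_ , p) | inj₂ (_ , q) = ⊥-elim (a≢c h (trans p (sym q)))

    at : b h ≡ v₀ ⊎ b h ≡ v₁ ⊎ b h ≡ v₂ ⊎ b h ≡ v₃ → _
    at (inj₁ e) = inj₂ (inj₂ (from-v₀ n01 n02 e to-a to-c))
    at (inj₂ (inj₁ refl)) =
      inj₁ (between h refl (at-v₁ (≢-sym n01) n12 n13 to-a) (at-v₁ (≢-sym n01) n12 n13 to-c))
    at (inj₂ (inj₂ (inj₁ refl))) = inj₂ (inj₁ (between h refl (by to-a) (by to-c)))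
      where
      by : ∀ {u} → Walk v₀ v₁ v₂ v₃ v₂ u → u ≡ v₁ ⊎ u ≡ v₃
      by = swap ∘ at-v₁ n23 (≢-sym n12) (≢-sym n02) ∘ reverse-walk
    at (inj₂ (inj₂ (inj₂ e)))
      with from-v₀ (≢-sym n23) (≢-sym n13) e (reverse-walk to-a) (reverse-walk to-c)
    ... | refl , refl , ac = inj₂ (inj₂ (refl , refl , swap ac))

  Consecutive : P3Sub G → P3Sub G → Set
  Consecutive h k = ∃ λ u → ∃ λ v → ∃ λ w → ∃ λ x → IsPath u v w h × IsPath v w x k

  rev : ∀ {x y z h} → IsPath x y z h → IsPath z y x h
  rev (e , ac) = e , swap ac

  -- Each path occupies two consecutive edges of the walk, and any two different such places share
  -- an edge.
  adjacent⇒consecutive : ∀ {h k} → P3Adj G h k → Consecutive h k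
  adjacent⇒consecutive {h} {k} (h≢k , union) = go union
    where
    pair : ∀ {v₀ v₁ v₂ v₃} →
           IsPath v₀ v₁ v₂ h ⊎ IsPath v₁ v₂ v₃ h ⊎ (v₀ ≡ v₃ × IsPath v₂ v₀ v₁ h) →
           IsPath v₀ v₁ v₂ k ⊎ IsPath v₁ v₂ v₃ k ⊎ (v₀ ≡ v₃ × IsPath v₂ v₀ v₁ k) →
           Consecutive h k
    pair (inj₁ p)                  (inj₁ q)                  = ⊥-elim (h≢k (same-path p q))
    pair (inj₁ p)                  (inj₂ (inj₁ q))           = _ , _ , _ , _ , p , q
    pair (inj₁ p)                  (inj₂ (inj₂ (_ , q)))     = _ , _ , _ , _ , rev p , rev q
    pair (inj₂ (inj₁ p))           (inj₁ q)                  = _ , _ , _ , _ , rev p , rev q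
    pair (inj₂ (inj₁ p))           (inj₂ (inj₁ q))           = ⊥-elim (h≢k (same-path p q))
    pair (inj₂ (inj₁ p))           (inj₂ (inj₂ (refl , q)))  = _ , _ , _ , _ , p , q
    pair (inj₂ (inj₂ (_ , p)))     (inj₁ q)                  = _ , _ , _ , _ , p , q
    pair (inj₂ (inj₂ (refl , p)))  (inj₂ (inj₁ q))           = _ , _ , _ , _ , rev p , rev q
    pair (inj₂ (inj₂ (_ , p)))     (inj₂ (inj₂ (_ , q)))     = ⊥-elim (h≢k (same-path p q))

    go : IsP4 G _ _ ⊎ IsC3 G _ _ → Consecutive h k
    go (inj₁ (v₀ , v₁ , v₂ , v₃ , (n01 , n02 , n03 , n12 , n13 , n23) , _ , es)) =
      pair (within-walk h n01 n02 n12 n13 n23 (λ e → to (es _ _) (inj₁ e)))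
           (within-walk k n01 n02 n12 n13 n23 (λ e → to (es _ _) (inj₂ e)))
    go (inj₂ (v₀ , v₁ , v₂ , (n01 , n02 , n12) , _ , es)) =
      pair (within-walk h n01 n02 n12 (≢-sym n01) (≢-sym n02) (λ e → to (es _ _) (inj₁ e)))
           (within-walk k n01 n02 n12 (≢-sym n01) (≢-sym n02) (λ e → to (es _ _) (inj₂ e)))

  left-adj : ∀ {x y z h} → IsPath x y z h → Adj G x y
  left-adj {h = h} (refl , inj₁ (refl , refl)) = ab h
  left-adj {h = h} (refl , inj₂ (refl , refl)) = adj-sym G (bc h)

  path-ends≢ : ∀ {x y z h} → IsPath x y z h → x ≢ z
  path-ends≢ {h = h} (refl , inj₁ (refl , refl)) = a≢c h
  path-ends≢ {h = h} (refl , inj₂ (refl , refl)) = ≢-sym (a≢c h)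

  consecutive⇒adjacent : ∀ {w x y z h k} → IsPath w x y h → IsPath x y z k → P3Adj G h k
  consecutive⇒adjacent {w} {x} {y} {z} {h} {k} p q = h≢k , union (w ≟ z)
    where
    w≢x = adj⇒≢ G (left-adj p)
    w≢y = path-ends≢ p
    x≢y = adj⇒≢ G (left-adj q)
    x≢z = path-ends≢ q
    y≢z = ≢-sym (adj⇒≢ G (left-adj (rev q)))

    h≢k : h ≢ k
    h≢k refl = x≢y (trans (sym (IsPath.centre p)) (IsPath.centre q))

    union : Dec (w ≡ z) → _
    union (yes refl) = inj₂ (w , x , y , (w≢x , w≢y , x≢y) , vs , es)
      where
      vs : ∀ u → (VSet G h u ⊎ VSet G k u) ⇔ (u ≡ w ⊎ u ≡ x ⊎ u ≡ y)
      vs u = mk⇔ [ to (VSet⇔ p u) , [ inj₂ ∘ inj₁ , [ inj₂ ∘ inj₂ , inj₁ ]′ ]′ ∘ to (VSet⇔ q u) ]′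
                 (inj₁ ∘ from (VSet⇔ p u))
      es : ∀ u v → (ESet G h u v ⊎ ESet G k u v) ⇔ Walk w x y w u v
      es u v = mk⇔ [ [ inj₁ , inj₂ ∘ inj₁ ]′ ∘ to (ESet⇔ p u v) , inj₂ ∘ to (ESet⇔ q u v) ]′
                   [ inj₁ ∘ from (ESet⇔ p u v) ∘ inj₁ , inj₂ ∘ from (ESet⇔ q u v) ]′
    union (no w≢z) =
      inj₁ (w , x , y , z , (w≢x , w≢y , w≢z , x≢y , x≢z , y≢z) , vs , es)
      where
      vs : ∀ u → (VSet G h u ⊎ VSet G k u) ⇔ (u ≡ w ⊎ u ≡ x ⊎ u ≡ y ⊎ u ≡ z)
      vs u = mk⇔ [ [ inj₁ , [ inj₂ ∘ inj₁ , inj₂ ∘ inj₂ ∘ inj₁ ]′ ]′ ∘ to (VSet⇔ p u)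
                 , inj₂ ∘ to (VSet⇔ q u) ]′
                 [ inj₁ ∘ from (VSet⇔ p u) ∘ inj₁ , inj₂ ∘ from (VSet⇔ q u) ]′
      es : ∀ u v → (ESet G h u v ⊎ ESet G k u v) ⇔ Walk w x y z u v
      es u v = mk⇔ [ [ inj₁ , inj₂ ∘ inj₁ ]′ ∘ to (ESet⇔ p u v) , inj₂ ∘ to (ESet⇔ q u v) ]′
                   [ inj₁ ∘ from (ESet⇔ p u v) ∘ inj₁ , inj₂ ∘ from (ESet⇔ q u v) ]′

  path-exists : ∀ {x y z} → Adj G x y → Adj G y z → x ≢ z → ∃ (IsPath x y z)
  path-exists {x} {y} {z} xy yz x≢z with <-cmp x z
  ... | tri< x<z _ _ = p3 x y z xy yz x<z , refl , inj₁ (refl , refl)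
  ... | tri≈ _ x≡z _ = ⊥-elim (x≢z x≡z)
  ... | tri> _ _ z<x = p3 z y x (adj-sym G yz) (adj-sym G xy) z<x , refl , inj₂ (refl , refl)

  path-ends : ∀ {x y z x′ y′ z′ h} → IsPath x y z h → IsPath x′ y′ z′ h →
              y ≡ y′ × ((x ≡ x′ × z ≡ z′) ⊎ (x ≡ z′ × z ≡ x′))
  path-ends (refl , inj₁ (refl , refl)) (e , d) = e , d
  path-ends (refl , inj₂ (refl , refl)) (e , inj₁ (p , q)) = e , inj₂ (q , p)
  path-ends (refl , inj₂ (refl , refl)) (e , inj₂ (p , q)) = e , inj₁ (q , p)

root : ∀ {H} G → (f : V H ↔ P3Sub G) →
       (∀ h k → E H h k ⇔ P3Adj G (Inverse.to f h) (Inverse.to f k)) → Root H G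
root {H} G f f-E = record
  { P      = λ a b c h → IsPath a b c (fun h)
  ; flip   = rev
  ; P⇒adj  = left-adj
  ; P⇒≢    = path-ends≢
  ; ends   = path-ends
  ; path   = λ ab bc a≢c → let (k , p) = path-exists ab bc a≢c
                           in Inverse.from f k , subst (IsPath _ _ _) (sym (fun∘inv k)) p
  ; unique = λ {_} {_} {_} {h} {k} p q →
               trans (sym (inv∘fun h)) (trans (cong (Inverse.from f) (same-path p q)) (inv∘fun k))
  ; view   = λ h → P3Sub.a (fun h) , P3Sub.b (fun h) , P3Sub.c (fun h) , refl , inj₁ (refl , refl)
  ; E⇒P    = λ e → adjacent⇒consecutive (to (f-E _ _) e)
  ; P⇒E    = λ p q → from (f-E _ _) (consecutive⇒adjacent p q)
  }
  where
  open P3Root G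
  fun = Inverse.to f
  fun∘inv : ∀ k → fun (Inverse.from f k) ≡ k
  fun∘inv k = Inverse.inverseˡ f refl
  inv∘fun : ∀ h → Inverse.from f (fun h) ≡ h
  inv∘fun h = Inverse.inverseʳ f refl

-- Tools for assembling an isomorphism step by step.

-- The theorem is a negation, so it suffices that the steps exist under ¬¬.
sweep : ∀ {ℓ} {X : Set ℓ} (_≤_ : X → X → Set) → (∀ x → x ≤ x) →
        (∀ {x y z} → x ≤ y → y ≤ z → x ≤ z) →
        ∀ {m} (Q : Fin m → X → Set) → (∀ {i x y} → x ≤ y → Q i x → Q i y) →
        (∀ i x → ¬ ¬ (Σ X λ y → x ≤ y × Q i y)) →
        ∀ x → ¬ ¬ (Σ X λ y → x ≤ y × ∀ i → Q i y)
sweep _≤_ ≤-refl ≤-trans {zero} Q mono step x k = k (x , ≤-refl x , λ ())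
sweep _≤_ ≤-refl ≤-trans {suc m} Q mono step x k =
  step zero x λ (y , x≤y , q) →
  sweep _≤_ ≤-refl ≤-trans (Q ∘ suc) mono (step ∘ suc) y λ (z , y≤z , qs) →
  k (z , ≤-trans x≤y y≤z , λ { zero → mono y≤z q ; (suc i) → qs i })

module _ {G G′ : Graph} (Rel : Vertex G → Vertex G′ → Set)
         (total : ∀ v → ∃ (Rel v)) (onto : ∀ v′ → ∃ λ v → Rel v v′)
         (functional : ∀ {v v₁ v₂} → Rel v v₁ → Rel v v₂ → v₁ ≡ v₂)
         (injective : ∀ {v₁ v₂ v′} → Rel v₁ v′ → Rel v₂ v′ → v₁ ≡ v₂)
         (adj⇒ : ∀ {v w v′ w′} → Rel v v′ → Rel w w′ → Adj G v w → Adj G′ v′ w′)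
         (adj⇐ : ∀ {v w v′ w′} → Rel v v′ → Rel w w′ → Adj G′ v′ w′ → Adj G v w) where
  relation⇒iso : Iso (toRaw G) (toRaw G′)
  relation⇒iso =
    mk↔ₛ′ (proj₁ ∘ total) (proj₁ ∘ onto)
          (λ v′ → functional (proj₂ (total _)) (proj₂ (onto v′)))
          (λ v → injective (proj₂ (onto _)) (proj₂ (total v))) ,
    λ v w → mk⇔ (adj⇒ (proj₂ (total v)) (proj₂ (total w)))
                (adj⇐ (proj₂ (total v)) (proj₂ (total w)))

-- Leaves, and agreement of two roots at an edge.

NoIsolated : RawGraph → Set
NoIsolated H = ∀ h → ¬ ¬ ∃ (E H h)

module Leaves {H : RawGraph} {G : Graph} (R : Root H G) (noIsolated : NoIsolated H) where
  open RootProperties R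

  -- An empty dart l → b says that l is a leaf. Two leaves at b would give a path l - b - l′ that is
  -- isolated in H.
  leaf-unique : ∀ {b l l′} → b ~ l → b ~ l′ → ¬ ∃ (D l b) → ¬ ∃ (D l′ b) → l ≡ l′
  leaf-unique {b} {l} {l′} bl bl′ leaf leaf′ = decidable-stable (l ≟ l′) λ l≢l′ →
    let (h , p) = path (adj-sym G bl) bl′ l≢l′
    in noIsolated h λ (k , e) → [ leaf ∘ (k ,_) , leaf′ ∘ (k ,_) ]′ (neighbour p e)

module Agreement {H : RawGraph} {G G′ : Graph} (R : Root H G) (R′ : Root H G′) where
  private
    module R  = RootProperties R
    module R′ = RootProperties R′

  -- `inhabited` excludes edges with two empty darts, any two of which would agree.
  record EdgeAgree (b c : Vertex G) (b′ c′ : Vertex G′) : Set where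
    constructor edgeAgree
    field
      adj   : R._~_ b c
      adj′  : R′._~_ b′ c′
      dart  : R.D b c ≐ R′.D b′ c′
      dart⁻ : R.D c b ≐ R′.D c′ b′
      inhabited : (∃ λ h → R.D b c h) ⊎ (∃ λ h → R.D c b h)

  open EdgeAgree public

  flip-edge : ∀ {b c b′ c′} → EdgeAgree b c b′ c′ → EdgeAgree c b c′ b′
  flip-edge ea = record
    { adj = adj-sym G (adj ea) ; adj′ = adj-sym G′ (adj′ ea)
    ; dart = dart⁻ ea ; dart⁻ = dart ea ; inhabited = swap (inhabited ea) }

  darts⇒edge : ∀ {b c b′ c′ h k} → R.D b c h → R.D c b k →
               R.D b c ≐ R′.D b′ c′ → R.D c b ≐ R′.D c′ b′ → EdgeAgree b c b′ c′
  darts⇒edge d _ e e⁻ = record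
    { adj = R.D⇒adj d ; adj′ = R′.D⇒adj (to (e _) d)
    ; dart = e ; dart⁻ = e⁻ ; inhabited = inj₁ (_ , d) }

  Agree : Set
  Agree = ∃ λ b → ∃ λ c → ∃ λ b′ → ∃ λ c′ → EdgeAgree b c b′ c′

  module _ (leaf-unique′ : ∀ {b l l′} → R′._~_ b l → R′._~_ b l′ →
                           ¬ ∃ (R′.D l b) → ¬ ∃ (R′.D l′ b) → l ≡ l′) where
    -- A nonempty dart b → c fixes the image of b as the centre of its paths. If only c → b is
    -- nonempty, c has a single image, and b₁ and b₂ are both leaves at it.
    edge-functional : ∀ {b c b₁ c₁ b₂ c₂} → EdgeAgree b c b₁ c₁ → EdgeAgree b c b₂ c₂ → b₁ ≡ b₂
    edge-functional {b} {c} {b₁} {c₁} {b₂} {c₂} ea ea′ =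
      decidable-stable (b₁ ≟ b₂) (λ b₁≢b₂ → impossible b₁≢b₂ (inhabited ea))
      where
      module _ (b₁≢b₂ : b₁ ≢ b₂) where
        empty : ¬ ∃ (R.D b c)
        empty (_ , d) = b₁≢b₂ (R′.center-unique (to (dart ea _) d) (to (dart ea′ _) d))
        impossible : ¬ (∃ (R.D b c) ⊎ ∃ (R.D c b))
        impossible (inj₁ d) = empty d
        impossible (inj₂ (_ , d)) with R′.center-unique (to (dart⁻ ea _) d) (to (dart⁻ ea′ _) d)
        ... | refl = b₁≢b₂ (leaf-unique′ (adj-sym G′ (adj′ ea)) (adj-sym G′ (adj′ ea′))
                             (λ (h , d) → empty (h , from (dart ea h) d))
                             (λ (h , d) → empty (h , from (dart ea′ h) d)))

open Agreement using (EdgeAgree; Agree; edgeAgree)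

module _ {H : RawGraph} {G G′ : Graph} {R : Root H G} {R′ : Root H G′} where
  private module A = Agreement R R′
  edge-sym : ∀ {b c b′ c′} → EdgeAgree R R′ b c b′ c′ → EdgeAgree R′ R b′ c′ b c
  edge-sym ea = record
    { adj = A.adj′ ea ; adj′ = A.adj ea
    ; dart = ≐-sym (A.dart ea) ; dart⁻ = ≐-sym (A.dart⁻ ea)
    ; inhabited = map (λ (h , d) → h , to (A.dart ea h) d) (λ (h , d) → h , to (A.dart⁻ ea h) d)
                      (A.inhabited ea) }

  agree-sym : Agree R R′ → Agree R′ R
  agree-sym (_ , _ , _ , _ , ea) = _ , _ , _ , _ , edge-sym ea

-- Spreading agreement over a connected graph.

module Propagation {H : RawGraph} {G G′ : Graph} (noIsolated : NoIsolated H) (R : Root H G) where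
  private module R = RootProperties R

  infix 4 _⊑_
  record _⊑_ (R₁ R₂ : Root H G′) : Set where
    constructor keeping
    field keep : ∀ {b c b′ c′} → EdgeAgree R R₁ b c b′ c′ → EdgeAgree R R₂ b c b′ c′
  open _⊑_

  ⊑-refl : ∀ R₁ → R₁ ⊑ R₁
  ⊑-refl _ = keeping id

  ⊑-trans : ∀ {R₁ R₂ R₃} → R₁ ⊑ R₂ → R₂ ⊑ R₃ → R₁ ⊑ R₃
  ⊑-trans l m = keeping (keep m ∘ keep l)

  VertexAgree : Root H G′ → Vertex G → Vertex G′ → Set
  VertexAgree R′ v v′ = (∀ w → Adj G v w → ∃ λ w′ → EdgeAgree R R′ v w v′ w′) ×
                        (∀ w′ → Adj G′ v′ w′ → ∃ λ w → EdgeAgree R R′ v w v′ w′)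

  vertex-mono : ∀ {R₁ R₂ v v′} → R₁ ⊑ R₂ → VertexAgree R₁ v v′ → VertexAgree R₂ v v′
  vertex-mono le (f , g) = (λ w a → let (w′ , e) = f w a in w′ , keep le e) ,
                           (λ w a → let (w′ , e) = g w a in w′ , keep le e)

  -- Agreement along bc determines a correspondence μ of the neighbours of c with those of c′.
  -- A path w - c - z and the path μ w - c′ - μ z then have the same neighbours in H, so swapping
  -- these twins makes the two roots agree at c without spoiling any agreement reached before.
  module AtEdge {b c : Vertex G} {b′ c′ : Vertex G′} (μ : Vertex G → Vertex G′) (μ-b : μ b ≡ b′) where

    Fixed : Root H G′ → Vertex G → Vertex G → Set
    Fixed R′ w z = ∀ {s} → R.P w c z s → Root.P R′ (μ w) c′ (μ z) s

    fixed-flip : ∀ {w z} R′ → Fixed R′ w z → Fixed R′ z w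
    fixed-flip R′ f p = Root.flip R′ (f (R.flip p))

    record State : Set₁ where
      field
        target : Root H G′
        edge   : EdgeAgree R target b c b′ c′
        fixed  : ∀ {w} → Fixed target b w

    record _≼_ (S₁ S₂ : State) : Set where
      open State
      field
        edges  : target S₁ ⊑ target S₂
        fixes  : ∀ {w z} → Fixed (target S₁) w z → Fixed (target S₂) w z
    open _≼_

    ≼-refl : ∀ S → S ≼ S
    ≼-refl S = record { edges = ⊑-refl _ ; fixes = id }

    ≼-trans : ∀ {S₁ S₂ S₃} → S₁ ≼ S₂ → S₂ ≼ S₃ → S₁ ≼ S₃
    ≼-trans l m = record { edges = ⊑-trans (edges l) (edges m) ; fixes = fixes m ∘ fixes l }

    module InState (S : State) where
      open State S
      private module R′ = RootProperties target
      open Agreement R target hiding (EdgeAgree; Agree; edgeAgree)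

      μ-path : ∀ {w q} → R.P b c w q → R′.P b′ c′ (μ w) q
      μ-path p = subst (λ z → R′.P z c′ _ _) μ-b (fixed p)

      spoke : ∀ {w} → R._~_ c w → w ≢ b → ∃ (R.P b c w)
      spoke cw w≢b = R.path (adj edge) cw (≢-sym w≢b)

      -- Different neighbours w of c give different paths b - c - w, hence different paths b′ - c′ -
      -- μ w. For w = b there is no such path, and μ b ≡ b′ is used instead.
      μ-injective : ∀ {v w} → R._~_ c v → R._~_ c w → μ v ≡ μ w → v ≡ w
      μ-injective {v} {w} cv cw e with v ≟ b | w ≟ b
      ... | yes refl | yes refl = refl
      ... | yes refl | no w≢b  =
        let (_ , p) = spoke cw w≢b in ⊥-elim (R′.P⇒≢ (μ-path p) (trans (sym μ-b) e))
      ... | no v≢b   | yes refl =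
        let (_ , p) = spoke cv v≢b in ⊥-elim (R′.P⇒≢ (μ-path p) (sym (trans e μ-b)))
      ... | no v≢b   | no w≢b  =
        let (_ , p) = spoke cv v≢b ; (_ , q) = spoke cw w≢b
            same = R′.unique (μ-path p) (subst (λ z → R′.P b′ c′ z _) (sym e) (μ-path q))
        in R.other-end p (subst (R.P b c w) (sym same) q)

      -- The neighbours of b - c - w in H are D b c together with D w c. The first set already
      -- agrees, hence so does the second.
      outer-dart : ∀ {w} → R._~_ c w → w ≢ b → R.D w c ≐ R′.D (μ w) c′
      outer-dart cw w≢b h with spoke cw w≢b
      ... | q , p = mk⇔ ⇒ ⇐
        where
        ⇒ : _ → _
        ⇒ d with R′.neighbour (μ-path p) (R.D⇒E (R.P⇒D p) d)
        ... | inj₂ d′ = d′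
        ... | inj₁ d′ = ⊥-elim (w≢b (R.center-unique d (from (dart edge h) d′)))
        ⇐ : _ → _
        ⇐ d with R.neighbour p (R′.D⇒E (R′.P⇒D (μ-path p)) d)
        ... | inj₂ d′ = d′
        ... | inj₁ d′ = ⊥-elim (R′.P⇒≢ (μ-path p) (R′.center-unique (to (dart edge h) d′) d))

      finish : (∀ w z → Fixed target w z) → VertexAgree target c c′
      finish fix = there , back
        where
        ⇒ : ∀ {w h} → R.D c w h → R′.D c′ (μ w) h
        ⇒ (_ , p) = R′.P⇒D (fix _ _ p)

        ⇐ : ∀ {w h} → R._~_ c w → w ≢ b → R′.D c′ (μ w) h → R.D c w h
        ⇐ {w} {h} cw w≢b (z′ , p′) with z′ ≟ b′
        ... | yes refl with from (dart⁻ edge h) (R′.P⇒Dˡ p′)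
        ... | v , p with μ-injective (R.P⇒adjʳ (R.flip p)) cw
                           (R′.other-end (μ-path (R.flip p)) p′)
        ... | refl = R.P⇒Dˡ p
        -- An end z′ other than b′ is some μ z, because D c b agrees with D c′ b′.
        ⇐ {w} {h} cw w≢b (z′ , p′) | no z′≢b′
          with R′.path (adj′ edge) (adj-sym G′ (R′.P⇒adj p′)) (≢-sym z′≢b′)
        ... | q , p″ with from (dart⁻ edge q) (R′.P⇒Dˡ p″)
        ... | z , r with R′.other-end (μ-path (R.flip r)) p″
        ... | refl with R.path (R.P⇒adj r) cw (λ { refl → R′.P⇒≢ p′ refl })
        ... | s , t = subst (R.D c w) (R′.unique (fix _ _ t) p′) (R.P⇒D t)

        edge-at : ∀ w → R._~_ c w → w ≢ b → EdgeAgree R target c w c′ (μ w)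
        edge-at w cw w≢b = let (_ , p) = spoke cw w≢b in record
          { adj = cw ; adj′ = R′.P⇒adjʳ (μ-path p)
          ; dart = λ h → mk⇔ ⇒ (⇐ cw w≢b) ; dart⁻ = outer-dart cw w≢b
          ; inhabited = inj₁ (_ , R.P⇒D p) }

        there : ∀ w → R._~_ c w → ∃ λ w′ → EdgeAgree R target c w c′ w′
        there w cw with w ≟ b
        ... | yes refl = b′ , flip-edge edge
        ... | no w≢b   = μ w , edge-at w cw w≢b

        back : ∀ w′ → R′._~_ c′ w′ → ∃ λ w → EdgeAgree R target c w c′ w′
        back w′ cw′ with w′ ≟ b′
        ... | yes refl = b , flip-edge edge
        ... | no w′≢b′ with R′.path (adj′ edge) cw′ (≢-sym w′≢b′)
        ... | q , p′ with from (dart⁻ edge q) (R′.P⇒Dˡ p′)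
        ... | w , p with R′.other-end (μ-path (R.flip p)) p′
        ... | refl = w , edge-at w (adj-sym G (R.P⇒adj p)) (R.P⇒≢ p)

      module Repair {w z s t} (p : R.P w c z s) (p′ : R′.P (μ w) c′ (μ z) t)
                    (w≢b : w ≢ b) (z≢b : z ≢ b) (s≢t : s ≢ t) where
        cw = adj-sym G (R.P⇒adj p)
        cz = R.P⇒adjʳ p

        s≈t : Twins H s t
        s≈t = ≐-trans (R.neighbour⇔ p) (≐-trans darts (≐-sym (R′.neighbour⇔ p′)))
          where
          darts : (λ k → R.D w c k ⊎ R.D z c k) ≐ (λ k → R′.D (μ w) c′ k ⊎ R′.D (μ z) c′ k)
          darts k = mk⇔ (map (to (ow k)) (to (oz k))) (map (from (ow k)) (from (oz k)))
            where ow = outer-dart cw w≢b ; oz = outer-dart cz z≢b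

        open TwinSwap target s≈t

        -- The path b - c - w tests the edge: its image b′ - c′ - μ w lies in the dart y′ → a′, so
        -- y′ is c′ and a′ is μ w or b′. The latter would make b an end of s.
        forward : ∀ {w z s t y′ a′} → R.P w c z s → R′.P (μ w) c′ (μ z) t → w ≢ b → z ≢ b →
                  EdgeAgree R target c w y′ a′ → R′.D y′ a′ s → R′.D y′ a′ t
        forward p p′ w≢b z≢b ea d with spoke (adj ea) w≢b
        ... | q , r with to (dart ea q) (R.P⇒D r)
        ... | d′ with R′.center-unique d′ (R′.P⇒D (μ-path r)) | R′.end-cases (μ-path r) d′
        ... | refl | inj₂ refl = R′.P⇒Dˡ p′
        ... | refl | inj₁ refl =
          ⊥-elim ([ w≢b ∘ sym , z≢b ∘ sym ]′ (R.end-cases p (from (dart⁻ edge _) d)))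

        backward : ∀ {w z s t y a} → R.P w c z s → R′.P (μ w) c′ (μ z) t → w ≢ b → z ≢ b →
                   EdgeAgree R target y a c′ (μ w) → R.D y a s
        backward {w} {z} {s} {t} {y} {a} p p′ w≢b z≢b ea with spoke (adj-sym G (R.P⇒adj p)) w≢b
        ... | q , r with from (dart ea q) (R′.P⇒D (μ-path r))
        ... | d with R.center-unique d (R.P⇒D r) | R.end-cases r d
        ... | refl | inj₂ refl = R.P⇒Dˡ p
        ... | refl | inj₁ refl with to (dart⁻ edge t) (from (dart ea t) (R′.P⇒Dˡ p′))
        ... | d′ with spoke (R.P⇒adjʳ p) z≢b | R′.end-cases p′ d′
        ... | _      | inj₁ e = ⊥-elim (R′.P⇒≢ (μ-path r) e)
        ... | _ , r′ | inj₂ e = ⊥-elim (R′.P⇒≢ (μ-path r′) e)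

        -- A dart survives the swap if it holds both twins or neither. By `forward` and `backward`,
        -- an agreeing edge whose dart holds one of them matches c w with c′ μ w, or c z with c′ μ
        -- z.
        kept : ∀ {y a y′ a′} → EdgeAgree R target y a y′ a′ → R.D y a ≐ S.D y′ a′
        kept {y} {a} {y′} {a′} ea = ≐-trans (dart ea) (≐-sym (D-stable ⇒ ⇐))
          where
          ⇒ : R′.D y′ a′ s → R′.D y′ a′ t
          ⇒ d with from (dart ea s) d
          ... | e with R.center-unique e (R.P⇒D p) | R.end-cases p e
          ... | refl | inj₁ refl = forward p p′ w≢b z≢b ea d
          ... | refl | inj₂ refl = forward (R.flip p) (R′.flip p′) z≢b w≢b ea d
          ⇐ : R′.D y′ a′ t → R′.D y′ a′ s
          ⇐ d with R′.center-unique d (R′.P⇒D p′) | R′.end-cases p′ d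
          ... | refl | inj₁ refl = to (dart ea s) (backward p p′ w≢b z≢b ea)
          ... | refl | inj₂ refl = to (dart ea s) (backward (R.flip p) (R′.flip p′) z≢b w≢b ea)

        edges-kept : target ⊑ swapped
        edges-kept = keeping λ ea → record
          { adj = adj ea ; adj′ = adj′ ea ; dart = kept ea ; dart⁻ = kept (flip-edge ea)
          ; inhabited = inhabited ea }

        -- The swap only touches paths that are s or t. Such a path, if fixed, would be w - c - z
        -- itself, and then s and t would be equal.
        fixed-kept : ∀ {v u} → Fixed target v u → Fixed swapped v u
        fixed-kept {v} {u} fix {h} r with transpose-cases h
        ... | inj₂ (inj₂ (_ , _ , e)) = subst (R′.P _ _ _) (sym e) (fix r)
        ... | inj₁ (refl , _) = ⊥-elim (s≢t (R′.unique (by (proj₂ (R.ends r p))) p′))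
          where
          by : (v ≡ w × u ≡ z) ⊎ (v ≡ z × u ≡ w) → R′.P (μ w) c′ (μ z) s
          by (inj₁ (refl , refl)) = fix r
          by (inj₂ (refl , refl)) = R′.flip (fix r)
        ... | inj₂ (inj₁ (refl , _)) = ⊥-elim (s≢t (R.unique p (by (proj₂ (R′.ends (fix r) p′)))))
          where
          cv = adj-sym G (R.P⇒adj r)
          cu = R.P⇒adjʳ r
          by : (μ v ≡ μ w × μ u ≡ μ z) ⊎ (μ v ≡ μ z × μ u ≡ μ w) → R.P w c z t
          by (inj₁ (e , f)) with μ-injective cv cw e | μ-injective cu cz f
          ... | refl | refl = r
          by (inj₂ (e , f)) with μ-injective cv cz e | μ-injective cu cw f
          ... | refl | refl = R.flip r

        repaired : State
        repaired = record { target = swapped ; edge = keep edges-kept edge ; fixed = fixed-kept fixed }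

        repaired-fixed : Fixed swapped w z
        repaired-fixed r with R.unique r p
        ... | refl = subst (R′.P _ _ _) (sym transpose-s) p′

      fix : ∀ w z → Σ State λ S′ → S ≼ S′ × Fixed (State.target S′) w z
      fix w z with w ≟ b | z ≟ b
      ... | yes refl | _        = S , ≼-refl S , fixed
      ... | no _     | yes refl = S , ≼-refl S , fixed-flip target fixed
      ... | no w≢b   | no z≢b
        with T? (Graph.adj G c w) | T? (Graph.adj G c z) | w ≟ z
      ... | no ¬cw | _      | _      = S , ≼-refl S , λ r → ⊥-elim (¬cw (adj-sym G (R.P⇒adj r)))
      ... | yes _  | no ¬cz | _      = S , ≼-refl S , λ r → ⊥-elim (¬cz (R.P⇒adjʳ r))
      ... | yes _  | yes _  | yes e  = S , ≼-refl S , λ r → ⊥-elim (R.P⇒≢ r e)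
      ... | yes cw | yes cz | no w≢z
        with spoke cw w≢b | spoke cz z≢b | R.path (adj-sym G cw) cz w≢z
      ... | _ , q | _ , r | s , p
        with R′.path (R′.P⇒adj (R′.flip (μ-path q))) (R′.P⇒adjʳ (μ-path r))
                     (w≢z ∘ μ-injective cw cz)
      ... | t , p′ with s R.≟V t
      ... | yes refl = S , ≼-refl S , λ r → subst (R′.P _ _ _) (R.unique p r) p′
      ... | no s≢t   = repaired , record { edges = edges-kept ; fixes = fixed-kept } , repaired-fixed
        where open Repair p p′ w≢b z≢b s≢t

    fix-all : ∀ S → ¬ ¬ (Σ State λ S′ → S ≼ S′ × ∀ w z → Fixed (State.target S′) w z)
    fix-all = sweep _≼_ ≼-refl ≼-trans (λ w S → ∀ z → Fixed (State.target S) w z)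
                (λ le f z → fixes le (f z))
                (λ w → sweep _≼_ ≼-refl ≼-trans (λ z S → Fixed (State.target S) w z)
                         (λ le → fixes le) (λ z S k → k (InState.fix S w z)))

  module _ {R′ : Root H G′} {b c b′ c′} (ea : EdgeAgree R R′ b c b′ c′) where
    open Agreement R R′ hiding (EdgeAgree; Agree; edgeAgree)
    private module R′ = RootProperties R′

    image : ∀ w → ∃ λ w′ → (w ≡ b → w′ ≡ b′) × (∀ {q} → R.P b c w q → R′.P b′ c′ w′ q)
    image w with w ≟ b | T? (Graph.adj G c w)
    -- At b the value b′ is prescribed; at non-neighbours of c it is a placeholder, as there is no
    -- path b - c - w.
    ... | yes refl | _      = b′ , (λ _ → refl) , λ r → ⊥-elim (R.P⇒≢ r refl)
    ... | no w≢b   | no ¬cw = b′ , (λ e → ⊥-elim (w≢b e)) , λ r → ⊥-elim (¬cw (R.P⇒adjʳ r))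
    ... | no w≢b   | yes cw with R.path (adj ea) cw (≢-sym w≢b)
    ... | q , p with to (dart⁻ ea q) (R.P⇒Dˡ p)
    ... | w′ , p′ = w′ , (λ e → ⊥-elim (w≢b e)) ,
                    λ r → subst (R′.P b′ c′ w′) (R.unique p r) (R′.flip p′)

    extend-at : ¬ ¬ (Σ (Root H G′) λ R″ → R′ ⊑ R″ × VertexAgree R″ c c′)
    extend-at k = fix-all start λ (S , le , fix) →
                  k (State.target S , edges le , InState.finish S fix)
      where
      μ : Vertex G → Vertex G′
      μ = proj₁ ∘ image
      μ-b : μ b ≡ b′
      μ-b = proj₁ (proj₂ (image b)) refl
      open AtEdge {b} {c} {b′} {c′} μ μ-b
      open _≼_
      start : State
      start = record
        { target = R′ ; edge = ea
        ; fixed = λ {w} p → subst (λ z → R′.P z c′ (μ w) _) (sym μ-b) (proj₂ (proj₂ (image w)) p) }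

  Reached : Vertex G → Root H G′ → Set
  Reached v R′ = ∃ (VertexAgree R′ v)

  extend-along : ∀ {b v} → Star (E (toRaw G)) b v → ∀ {R′} → Reached b R′ →
                 ¬ ¬ (Σ (Root H G′) λ R″ → R′ ⊑ R″ × Reached v R″)
  extend-along ε r k = k (_ , ⊑-refl _ , r)
  extend-along (bc ◅ cs) {R′} (b′ , f , _) k =
    extend-at (proj₂ (f _ bc)) λ (R₁ , le₁ , r₁) →
    extend-along cs (_ , r₁) λ (R₂ , le₂ , r₂) → k (R₂ , ⊑-trans le₁ le₂ , r₂)

  extend : Connected (toRaw G) → ∀ R′ → Agree R R′ →
           ¬ ¬ (Σ (Root H G′) λ R″ → ∀ v → Reached v R″)
  extend (_ , conn) R′ (_ , c , _ , c′ , ea) k =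
    extend-at ea λ (R₁ , le , r) →
    sweep {X = Σ (Root H G′) λ R₂ → VertexAgree R₂ c c′}
          (λ x y → proj₁ x ⊑ proj₁ y) (⊑-refl ∘ proj₁) ⊑-trans
          (λ v x → Reached v (proj₁ x))
          (λ le (v′ , r) → v′ , vertex-mono le r)
          (λ v (R₂ , r₂) k → extend-along (conn c v) (c′ , r₂)
             λ (R₃ , le₃ , r₃) → k ((R₃ , vertex-mono le₃ r₂) , le₃ , r₃))
          (R₁ , r) λ ((R₂ , _) , _ , rs) → k (R₂ , rs)

  module _ (conn : Connected (toRaw G)) (conn′ : Connected (toRaw G′))
           (h₀ : V H) (R′ : Root H G′) where
    private module R′ = RootProperties R′
    open Agreement R R′ hiding (EdgeAgree; Agree; edgeAgree)

    -- A vertex without neighbours would agree vacuously with others of its kind; a connected graph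
    -- that contains a path on three vertices has none.
    has-neighbour : ∀ v → ∃ (Adj G v)
    has-neighbour v with R.view h₀
    ... | a , b , _ , p with proj₂ conn v b
    ... | ε     = a , adj-sym G (R.P⇒adj p)
    ... | e ◅ _ = _ , e

    has-neighbour′ : ∀ v → ∃ (Adj G′ v)
    has-neighbour′ v with R′.view h₀
    ... | a , b , _ , p with proj₂ conn′ v b
    ... | ε     = a , adj-sym G′ (R′.P⇒adj p)
    ... | e ◅ _ = _ , e

    all-reached⇒iso : (∀ v → Reached v R′) → Iso (toRaw G) (toRaw G′)
    all-reached⇒iso reached = relation⇒iso {G} {G′} (VertexAgree R′) reached onto functional injective adj⇒ adj⇐
      where
      edge-fun : ∀ {b c b₁ c₁ b₂ c₂} →
                 EdgeAgree R R′ b c b₁ c₁ → EdgeAgree R R′ b c b₂ c₂ → b₁ ≡ b₂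
      edge-fun = edge-functional (Leaves.leaf-unique R′ noIsolated)

      edge-inj : ∀ {b₁ c₁ b₂ c₂ b′ c′} →
                 EdgeAgree R R′ b₁ c₁ b′ c′ → EdgeAgree R R′ b₂ c₂ b′ c′ → b₁ ≡ b₂
      edge-inj ea ea′ = Agreement.edge-functional R′ R (Leaves.leaf-unique R noIsolated)
                          (edge-sym ea) (edge-sym ea′)

      functional : ∀ {v v₁ v₂} → VertexAgree R′ v v₁ → VertexAgree R′ v v₂ → v₁ ≡ v₂
      functional {v} (f , _) (g , _) =
        let (w , a) = has-neighbour v in edge-fun (proj₂ (f w a)) (proj₂ (g w a))

      injective : ∀ {v₁ v₂ v′} → VertexAgree R′ v₁ v′ → VertexAgree R′ v₂ v′ → v₁ ≡ v₂
      injective {v′ = v′} (_ , f) (_ , g) =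
        let (w , a) = has-neighbour′ v′ in edge-inj (proj₂ (f w a)) (proj₂ (g w a))

      edge⇒vertex : ∀ {v w v′ w′} → EdgeAgree R R′ v w v′ w′ → VertexAgree R′ v v′
      edge⇒vertex {v} {w} ea with reached v
      ... | v″ , f , g with edge-fun ea (proj₂ (f w (adj ea)))
      ... | refl = f , g

      spread : ∀ {v v′ w′} → VertexAgree R′ v v′ → Star (E (toRaw G′)) v′ w′ →
               ∃ λ w → VertexAgree R′ w w′
      spread r ε = _ , r
      spread (_ , g) (e ◅ es) = spread (edge⇒vertex (flip-edge (proj₂ (g _ e)))) es

      onto : ∀ v′ → ∃ λ v → VertexAgree R′ v v′
      onto v′ = let (v , r) = reached (proj₁ conn) in spread r (proj₂ conn′ v v′)

      adj⇒ : ∀ {v w v′ w′} → VertexAgree R′ v v′ → VertexAgree R′ w w′ → Adj G v w → Adj G′ v′ w′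
      adj⇒ {w = w} (f , _) r vw with f w vw
      ... | w″ , ea with functional r (edge⇒vertex (flip-edge ea))
      ... | refl = adj′ ea

      adj⇐ : ∀ {v w v′ w′} → VertexAgree R′ v v′ → VertexAgree R′ w w′ → Adj G′ v′ w′ → Adj G v w
      adj⇐ {w′ = w′} (_ , g) r vw with g w′ vw
      ... | w″ , ea with injective r (edge⇒vertex (flip-edge ea))
      ... | refl = adj ea

agree⇒iso : ∀ {H G G′} → NoIsolated H → V H → Connected (toRaw G) → Connected (toRaw G′) →
            {R : Root H G} {R′ : Root H G′} → Agree R R′ → ¬ ¬ Iso (toRaw G) (toRaw G′)
agree⇒iso noIsolated h₀ conn conn′ {R} {R′} a k =
  extend conn R′ a λ (R″ , reached) → k (all-reached⇒iso conn conn′ h₀ R″ reached)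
  where open Propagation noIsolated R

-- Quantified over all roots, because roots get recomposed with automorphisms of H before they are
-- compared.
Conflict : RawGraph → Graph → Graph → Set₁
Conflict H G G′ = (R : Root H G) (R′ : Root H G′) → ¬ Agree R R′

conflict-sym : ∀ {H G G′} → Conflict H G G′ → Conflict H G′ G
conflict-sym conflict R R′ = conflict R′ R ∘ agree-sym

-- Squares of H and heavy edges of a root.

module Squares {H : RawGraph} {G : Graph} (R : Root H G) where
  open RootProperties R

  record Biclique (h h′ k k′ : V H) : Set where
    constructor biclique
    field
      {b c} : Vertex G
      bc  : D b c h
      bc′ : D b c h′
      cb  : D c b k
      cb′ : D c b k′

  record Cycle (h h′ k k′ : V H) : Set where
    constructor cycle
    field
      {x y α β} : Vertex G
      αxβ : P α x β h
      αyβ : P α y β h′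
      xαy : P x α y k
      xβy : P x β y k′

  cycle-swap : ∀ {h h′ k k′} → Cycle h h′ k k′ → Cycle h′ h k k′
  cycle-swap (cycle p p′ q q′) = cycle p′ p (flip q) (flip q′)

  cycle-swap′ : ∀ {h h′ k k′} → Cycle h h′ k k′ → Cycle h h′ k′ k
  cycle-swap′ (cycle p p′ q q′) = cycle (flip p) (flip p′) q′ q

  cycle-dual : ∀ {h h′ k k′} → Cycle h h′ k k′ → Cycle k k′ h h′
  cycle-dual (cycle p p′ q q′) = cycle q q′ p p′

  biclique-or-cycle : ∀ {h h′ k k′} → h ≢ h′ → k ≢ k′ →
                      E H h k → E H h k′ → E H h′ k → E H h′ k′ →
                      Biclique h h′ k k′ ⊎ Cycle h h′ k k′
  biclique-or-cycle n n′ hk hk′ h′k h′k′ with square n n′ hk hk′ h′k h′k′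
  ... | inj₁ (_ , _ , d , d′ , e , e′)         = inj₁ (biclique d d′ e e′)
  ... | inj₂ (_ , _ , _ , _ , p , p′ , q , q′) = inj₂ (cycle p p′ q q′)

  Third : (x y c : Vertex G) → Set
  Third x y c = ∃ λ e → e ~ c × e ≢ x × e ≢ y

  third-swap : ∀ {x y c} → Third x y c → Third y x c
  third-swap (e , ec , e≢x , e≢y) = e , ec , e≢y , e≢x

open Squares using (Biclique; biclique; Cycle; cycle)

module _ {H : RawGraph} {G G′ : Graph} (R : Root H G) (R′ : Root H G′) where
  private
    module R  = RootProperties R
    module R′ = RootProperties R′

  -- Two distinct elements of D c b determine D b c as the set of their common neighbours in H, so
  -- the square fixes both darts.
  bicliques⇒agree : ∀ {h h′ k k′} → h ≢ h′ → k ≢ k′ →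
                    Biclique R h h′ k k′ → Biclique R′ h h′ k k′ → Agree R R′
  bicliques⇒agree n n′ (biclique {b} {c} d d′ e e′) (biclique {b′} {c′} f f′ g g′) =
    b , c , b′ , c′ , Agreement.darts⇒edge R R′ d e
      (λ x → mk⇔ (λ r → R′.common-neighbour g g′ n′ (R.D⇒E e r) (R.D⇒E e′ r))
                 (λ r → R.common-neighbour e e′ n′ (R′.D⇒E g r) (R′.D⇒E g′ r)))
      (λ x → mk⇔ (λ r → R′.common-neighbour f f′ n (R.D⇒E d r) (R.D⇒E d′ r))
                 (λ r → R.common-neighbour d d′ n (R′.D⇒E f r) (R′.D⇒E f′ r)))

  -- The biclique of a heavy edge bc of G comes from a 4-cycle of G′. Then G has a 4-cycle u b c w,
  -- and conversely the 4-cycle of H it induces comes from a heavy edge of G′.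
  module _ {b c u w : Vertex G} {i i′ j j′ : V H}
           (ubc : R.P u b c i) (bc′ : R.D b c i′) (bcw : R.P b c w j) (cb′ : R.D c b j′)
           (X : Cycle R′ i i′ j j′) where
    open Cycle X

    -- The path t is adjacent to i, so in G′ it is centred at α or β. Its far end there is not y,
    -- since otherwise t would be j or j′, which are centred at c and not at u.
    third : ∀ {t} → R.D u b t → Squares.Third R′ x y α ⊎ Squares.Third R′ x y β
    third {t} d with R′.neighbour αxβ (R.D⇒E (R.P⇒Dˡ ubc) d)
    ... | inj₁ (e , q) = inj₁ (e , R′.P⇒adj q , R′.P⇒≢ q , λ { refl → R.P⇒≢ ubc
            (R.center-unique (subst (R.D u b) (R′.unique (R′.flip q) xαy) d) (R.P⇒D bcw)) })
    ... | inj₂ (e , q) = inj₂ (e , R′.P⇒adj q , R′.P⇒≢ q , λ { refl → R.P⇒≢ ubc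
            (R.center-unique (subst (R.D u b) (R′.unique (R′.flip q) xβy) d) cb′) })

    -- Third neighbours of α and x make α x heavy in G′, which gives a square of H through i and j.
    -- In G it is not the biclique of an edge: this edge would be b c, and x - α - e would be
    -- adjacent to i′. So it comes from a 4-cycle of G, whose side opposite b c is u w.
    closing-edge : Squares.Third R′ x y α → Squares.Third R′ α β x → R._~_ u w
    closing-edge (e , ec , e≢x , e≢y) (g , gx , g≢c , g≢a)
      with R′.path (R′.P⇒adj xαy) (adj-sym G′ ec) (≢-sym e≢x)
         | R′.path (R′.P⇒adj αxβ) (adj-sym G′ gx) (≢-sym g≢c)
    ... | t , xce | m , cxg
      with Squares.biclique-or-cycle R
             (λ { refl → g≢a (sym (R′.other-end αxβ cxg)) })
             (λ { refl → e≢y (sym (R′.other-end xαy xce)) })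
             (R′.D⇒E (R′.P⇒Dˡ αxβ) (R′.P⇒Dˡ xαy)) (R′.D⇒E (R′.P⇒Dˡ αxβ) (R′.P⇒Dˡ xce))
             (R′.D⇒E (R′.P⇒Dˡ cxg) (R′.P⇒Dˡ xαy)) (R′.D⇒E (R′.P⇒Dˡ cxg) (R′.P⇒Dˡ xce))
    ... | inj₁ (biclique d _ d′ d″)
      with R.center-unique d (R.P⇒D ubc) | R.center-unique d′ (R.P⇒D bcw)
    ... | refl | refl with R′.neighbour αyβ (R.D⇒E bc′ d″)
    ... | inj₁ f = ⊥-elim ([ R′.P⇒≢ xαy ∘ sym , e≢y ∘ sym ]′ (R′.end-cases xce f))
    ... | inj₂ f = ⊥-elim (R′.P⇒≢ αxβ (R′.center-unique (R′.P⇒D xce) f))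
    closing-edge _ _ | t , xce | m , cxg | inj₂ (cycle p p′ q _)
      with R.center-unique (R.P⇒D p) (R.P⇒D ubc) | R.center-unique (R.P⇒D q) (R.P⇒D bcw)
    ... | refl | refl with R.other-end q bcw | R.other-end p (R.flip ubc)
    ... | refl | refl = adj-sym G (R.P⇒adjʳ p′)

    module _ (uw : R._~_ u w) where
      private
        s,p = R.path (R.P⇒adjʳ bcw) (adj-sym G uw) (λ { refl → R.P⇒≢ ubc refl })
        t,p = R.path (adj-sym G (R.P⇒adj ubc)) uw (R.P⇒≢ bcw)

      s t : V H
      s = proj₁ s,p
      t = proj₁ t,p

      i≢s : i ≢ s
      i≢s e = R.P⇒≢ bcw (R.center-unique (subst (R.D b c) e (R.P⇒D ubc)) (R.P⇒Dˡ (proj₂ s,p)))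

      j≢t : j ≢ t
      j≢t e = R.P⇒≢ ubc (sym (R.center-unique (subst (R.D c w) e (R.P⇒D bcw)) (R.P⇒D (proj₂ t,p))))

      -- The 4-cycle u b c w of G gives the square i j s t of H. If this came from a 4-cycle of G′,
      -- it would again be α x β y, and `s`, which is centred at w, would equal i′, which is centred
      -- at b.
      other-biclique : Biclique R′ i s j t
      other-biclique
        with Squares.biclique-or-cycle R′ i≢s j≢t
               (R.P⇒E ubc bcw) (R.D⇒E (R.P⇒Dˡ ubc) (R.P⇒Dˡ (proj₂ t,p)))
               (R.D⇒E (R.P⇒Dˡ (proj₂ s,p)) (R.P⇒D bcw)) (R.P⇒E (proj₂ s,p) (R.flip (proj₂ t,p)))
      ... | inj₁ B = B
      ... | inj₂ (cycle p p′ q _)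
        with R′.center-unique (R′.P⇒D p) (R′.P⇒D αxβ) | R′.center-unique (R′.P⇒D q) (R′.P⇒D xαy)
      ... | refl | refl with R′.other-end q xαy | R′.other-end p αxβ
      ... | refl | refl = ⊥-elim (R.P⇒≢ bcw (R.center-unique bc′
              (subst (R.D w c) (R′.unique p′ αyβ) (R.P⇒Dˡ (proj₂ s,p)))))

module Heavy {H : RawGraph} (noIsolated : NoIsolated H) {G : Graph} (R : Root H G) where
  open RootProperties R
  open Leaves R noIsolated

  -- An edge both of whose ends have degree at least three.
  HeavyEdge : Set
  HeavyEdge = ∃ λ h → ∃ λ h′ → ∃ λ k → ∃ λ k′ → h ≢ h′ × k ≢ k′ × Biclique R h h′ k k′

  module _ {G′ : Graph} (R′ : Root H G′) where
    open Squares R′ using (Third; third-swap; cycle-swap; cycle-swap′; cycle-dual)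

    -- The vertices u and v are not both leaves at b, so `third` applies at one of them.
    some-third : ∀ {b c u v i i′ j j′} → P u b c i → P v b c i′ → D c b j → D c b j′ → u ≢ v →
                 (X : Cycle R′ i i′ j j′) → let open Cycle X in ¬ ¬ (Third x y α ⊎ Third x y β)
    some-third ubc vbc (w , wcb) cb′ u≢v X k =
      u≢v (leaf-unique (adj-sym G (P⇒adj ubc)) (adj-sym G (P⇒adj vbc))
            (λ (t , d) → k (third R R′ ubc (P⇒D vbc) (flip wcb) cb′ X d))
            (λ (t , d) → k (map third-swap third-swap (third R R′ vbc (P⇒D ubc) (flip wcb) cb′ (cycle-swap X) d))))

    closing-square : ∀ {b c u v w z i i′ j j′} →
      P u b c i → P v b c i′ → P b c w j → P b c z j′ → u ≢ v → w ≢ z → Cycle R′ i i′ j j′ →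
      ¬ ¬ ((u ~ w ⊎ u ~ z) ⊎ (v ~ w ⊎ v ~ z))
    closing-square ubc vbc bcw bcz u≢v w≢z X k =
      some-third ubc vbc (P⇒Dˡ bcw) (P⇒Dˡ bcz) u≢v X λ tc →
      some-third (flip bcw) (flip bcz) (P⇒D ubc) (P⇒D vbc) w≢z (cycle-dual X) λ tx →
      k (by tc tx)
      where
      open Cycle X
      by : Third x y α ⊎ Third x y β → Third α β x ⊎ Third α β y → _
      by (inj₁ tc) (inj₁ tx) = inj₁ (inj₁ (closing-edge R R′ ubc (P⇒D vbc) bcw (P⇒Dˡ bcz) X tc tx))
      by (inj₂ ta) (inj₁ tx) = inj₁ (inj₂ (closing-edge R R′ ubc (P⇒D vbc) bcz (P⇒Dˡ bcw)
                                 (cycle-swap′ X) ta (third-swap tx)))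
      by (inj₁ tc) (inj₂ ty) = inj₂ (inj₁ (closing-edge R R′ vbc (P⇒D ubc) bcw (P⇒Dˡ bcz)
                                 (cycle-swap X) (third-swap tc) ty))
      by (inj₂ ta) (inj₂ ty) = inj₂ (inj₂ (closing-edge R R′ vbc (P⇒D ubc) bcz (P⇒Dˡ bcw)
                                 (cycle-swap′ (cycle-swap X)) (third-swap ta) (third-swap ty)))

  no-heavy : ∀ {G₁ G₂} → Root H G₁ → Root H G₂ →
             Conflict H G G₁ → Conflict H G G₂ → Conflict H G₁ G₂ → ¬ HeavyEdge
  no-heavy {G₁} {G₂} R₁ R₂ c₁ c₂ c₁₂ (h , h′ , k , k′ , n , n′ , B) =
    both (Squares.biclique-or-cycle R₁ n n′ hk hk′ h′k h′k′)
         (Squares.biclique-or-cycle R₂ n n′ hk hk′ h′k h′k′)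
    where
    open Biclique B
    hk   = D⇒E bc cb
    hk′  = D⇒E bc cb′
    h′k  = D⇒E bc′ cb
    h′k′ = D⇒E bc′ cb′
    ubc = proj₂ bc
    vbc = proj₂ bc′
    bcw = flip (proj₂ cb)
    bcz = flip (proj₂ cb′)

    finish : ∀ {u w i i′ j j′} → P u b c i → D b c i′ → P b c w j → D c b j′ → u ~ w →
             Cycle R₁ i i′ j j′ → Cycle R₂ i i′ j j′ → ⊥
    -- Both other roots see the square of u b c w as a biclique, hence they agree.
    finish p d q d′ uw X Y = c₁₂ R₁ R₂
      (bicliques⇒agree R₁ R₂ (i≢s R R₁ p d q d′ X uw) (j≢t R R₁ p d q d′ X uw)
        (other-biclique R R₁ p d q d′ X uw) (other-biclique R R₂ p d q d′ Y uw))

    both : Biclique R₁ h h′ k k′ ⊎ Cycle R₁ h h′ k k′ →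
           Biclique R₂ h h′ k k′ ⊎ Cycle R₂ h h′ k k′ → ⊥
    both (inj₁ B₁) _         = c₁ R R₁ (bicliques⇒agree R R₁ n n′ B B₁)
    both (inj₂ _)  (inj₁ B₂) = c₂ R R₂ (bicliques⇒agree R R₂ n n′ B B₂)
    both (inj₂ X)  (inj₂ Y)  =
      closing-square R₁ ubc vbc bcw bcz (λ { refl → n (unique ubc vbc) })
        (λ { refl → n′ (unique bcw bcz) }) X
        [ [ (λ uw → finish ubc bc′ bcw cb′ uw X Y)
          , (λ uz → finish ubc bc′ bcz cb uz (S₁.cycle-swap′ X) (S₂.cycle-swap′ Y)) ]′
        , [ (λ vw → finish vbc bc bcw cb′ vw (S₁.cycle-swap X) (S₂.cycle-swap Y))
          , (λ vz → finish vbc bc bcz cb vz (S₁.cycle-swap′ (S₁.cycle-swap X))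
                                            (S₂.cycle-swap′ (S₂.cycle-swap Y))) ]′ ]′
      where
      module S₁ = Squares R₁
      module S₂ = Squares R₂

-- Paths whose centre has degree two.

record ThreeNeighbours (H : RawGraph) (h : V H) : Set where
  constructor three
  field
    {k₁ k₂ k₃} : V H
    e₁ : E H h k₁
    e₂ : E H h k₂
    e₃ : E H h k₃
    k₁≢k₂ : k₁ ≢ k₂
    k₁≢k₃ : k₁ ≢ k₃
    k₂≢k₃ : k₂ ≢ k₃

module ThinPaths {H : RawGraph} {G : Graph} (R : Root H G) where
  open RootProperties R

  -- In other words, the centre of h has degree two.
  Thin : V H → Set
  Thin h = ∀ {b c e k} → D b c h → D b e k → k ≡ h

  -- A third neighbour f of b would put the path f - b - c into the dart next to h.
  dart-unique⇒thin : ∀ {b c h} → D b c h → (∀ {k} → D b c k → k ≡ h) → Thin h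
  dart-unique⇒thin {b} {c} {h} (a , p) only {e = e} {k} d d′ with center-unique d (a , p)
  ... | refl with e ≟ c
  ... | yes refl = only d′
  ... | no e≢c with end-cases p (toward e≢c (D⇒adj d′))
    where
    toward : ∀ {f} → f ≢ c → b ~ f → D b f h
    toward f≢c bf with path (adj-sym G bf) (P⇒adjʳ p) f≢c
    ... | _ , r = subst (D b _) (only (P⇒D r)) (P⇒Dˡ r)
  ... | inj₂ e≡c = ⊥-elim (e≢c e≡c)
  ... | inj₁ refl with proj₁ d′ ≟ c
  ... | yes refl = only (P⇒Dˡ (proj₂ d′))
  ... | no f≢c with path (P⇒adj (proj₂ d′)) (P⇒adjʳ p) f≢c
  ... | _ , r with end-cases p (subst (D b _) (only (P⇒D r)) (P⇒Dˡ r))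
  ... | inj₁ f≡a = ⊥-elim (P⇒≢ (proj₂ d′) f≡a)
  ... | inj₂ f≡c = ⊥-elim (f≢c f≡c)

  module _ (noIsolated : NoIsolated H) (light : ¬ Heavy.HeavyEdge noIsolated R) where
    light⇒thin : ∀ {b c h h′ k} → D b c h → D b c h′ → h ≢ h′ → D c b k → Thin k
    light⇒thin d d′ n e = dart-unique⇒thin e λ {k} e′ → decidable-stable (k ≟V _) λ n′ →
      light (_ , _ , _ , _ , n , n′ , biclique d d′ e′ e)

    -- Two of the three neighbours are centred at the same end of q. The dart from that end to the
    -- centre of q has two elements, so lightness makes the opposite dart a singleton.
    three⇒thin : ∀ {q} → ThreeNeighbours H q → Thin q
    three⇒thin {q} (three e₁ e₂ e₃ n₁₂ n₁₃ n₂₃) with view q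
    ... | _ , _ , _ , p with neighbour p e₁ | neighbour p e₂ | neighbour p e₃
    ... | inj₁ d | inj₁ d′ | _       = light⇒thin d d′ n₁₂ (P⇒Dˡ p)
    ... | inj₁ d | inj₂ _  | inj₁ d′ = light⇒thin d d′ n₁₃ (P⇒Dˡ p)
    ... | inj₁ _ | inj₂ d  | inj₂ d′ = light⇒thin d d′ n₂₃ (P⇒D p)
    ... | inj₂ _ | inj₁ d  | inj₁ d′ = light⇒thin d d′ n₂₃ (P⇒Dˡ p)
    ... | inj₂ d | inj₁ _  | inj₂ d′ = light⇒thin d d′ n₁₃ (P⇒D p)
    ... | inj₂ d | inj₂ d′ | _       = light⇒thin d d′ n₁₂ (P⇒D p)

open ThinPaths using (Thin)

-- In either root, q and m lie on opposite darts of one edge, and thinness reduces these darts to q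
-- and m alone.
thin⇒agree : ∀ {H G G′} (R : Root H G) (R′ : Root H G′) {q m} → E H q m →
             Thin R q → Thin R m → Thin R′ q → Thin R′ m → Agree R R′
thin⇒agree R R′ {q} {m} e tq tm tq′ tm′ with RootProperties.E⇒D R e | RootProperties.E⇒D R′ e
... | b , c , d , d⁻ | b′ , c′ , d′ , d′⁻ =
  b , c , b′ , c′ , Agreement.darts⇒edge R R′ d d⁻ (only tq tq′ d d′) (only tm tm′ d⁻ d′⁻)
  where
  module R  = RootProperties R
  module R′ = RootProperties R′
  only : ∀ {h b c b′ c′} → Thin R h → Thin R′ h → R.D b c h → R′.D b′ c′ h →
         R.D b c ≐ R′.D b′ c′
  only {b = b} {c} {b′} {c′} t t′ d d′ k =
    mk⇔ (λ e → subst (R′.D b′ c′) (sym (t d e)) d′) (λ e → subst (R.D b c) (sym (t′ d′ e)) d)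

-- The surroundings of a fork q of H.

-- Around a vertex q of H all of whose neighbours have degree at most two:
-- for such a neighbour a, `Tail a` has at most one element.
module Around (H : RawGraph) (q : V H) where
  Tail : V H → V H → Set
  Tail a h = E H a h × h ≢ q

  Untwinned : V H → Set
  Untwinned a = E H q a × (∀ {b} → b ≢ a → ¬ Twins H a b)

  -- For a = c - s - u and b = c - s - u′ this describes the neighbourhood of u - s - u′.
  Link : V H → V H → V H → Set
  Link a b r = E H r ≐ (λ h → Tail a h ⊎ Tail b h)

  link-sym : ∀ {a b r} → Link a b r → Link b a r
  link-sym l h = mk⇔ (swap ∘ to (l h)) (from (l h) ∘ swap)

  TwoLinks : V H → V H → Set
  TwoLinks a b = ∃ λ r → ∃ λ r′ → r ≢ r′ × Link a b r × Link a b r′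

  twins⇒tails : ∀ {a b} → Twins H a b → Tail a ≐ Tail b
  twins⇒tails t h = mk⇔ (λ (e , n) → to (t h) e , n) (λ (e , n) → from (t h) e , n)

module Local {H : RawGraph} (noIsolated : NoIsolated H) {G : Graph} (R : Root H G) (q : V H)
             (thin : Thin R q) (few : ∀ {m} → E H q m → ¬ ThreeNeighbours H m) where
  open RootProperties R
  open Leaves R noIsolated
  open ThinPaths R using (dart-unique⇒thin)
  open Around H q

  c : Vertex G
  c = proj₁ (proj₂ (view q))

  centre : V H → Vertex G
  centre h = proj₁ (proj₂ (view h))

  centre-D : ∀ {b e h} → D b e h → centre h ≡ b
  centre-D {h = h} d = center-unique (P⇒D (proj₂ (proj₂ (proj₂ (view h))))) d

  locate : ∀ {a} → E H q a → ∃ λ u → D c (centre a) q × P c (centre a) u a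
  locate {a} e with view q
  ... | _ , _ , _ , p with neighbour p e
  ... | inj₁ (u , r) with centre-D (u , r)
  ... | refl = u , P⇒Dˡ p , flip r
  locate {a} e | _ , _ , _ , p | inj₂ (u , r) with centre-D (u , r)
  ... | refl = u , P⇒D p , flip r

  tail⇔ : ∀ {s u a} → D c s q → P c s u a → Tail a ≐ D u s
  tail⇔ d p h = mk⇔ ⇒ ⇐
    where
    ⇒ : _ → _
    ⇒ (e , h≢q) with neighbour p e
    ... | inj₁ d′ = ⊥-elim (h≢q (thin d d′))
    ... | inj₂ d′ = d′
    ⇐ : _ → _
    ⇐ d′ = D⇒E (P⇒D p) d′ , λ { refl → P⇒≢ p (center-unique d d′) }

  tail-unique : ∀ {a h h′} → E H q a → Tail a h → Tail a h′ → h ≡ h′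
  tail-unique {a} {h} {h′} qa (e , n) (e′ , n′) = decidable-stable (h ≟V h′) λ h≢h′ →
    few qa (three (E-sym qa) e e′ (≢-sym n) (≢-sym n′) h≢h′)

  tail-thin : ∀ {a h} → E H q a → Tail a h → Thin R h
  tail-thin qa t with locate qa
  ... | _ , d , p = dart-unique⇒thin (to (tail⇔ d p _) t)
                      λ d′ → tail-unique qa (from (tail⇔ d p _) d′) t

  tail? : ∀ {a} → E H q a → Dec (∃ (Tail a))
  tail? {a} qa with locate qa
  ... | u , d , p = map′ yes′ no′ (any? λ z → T? (Graph.adj G u z) ×-dec ¬? (z ≟ centre a))
    where
    yes′ : (∃ λ z → u ~ z × z ≢ centre a) → ∃ (Tail a)
    yes′ (z , uz , z≢s) with path (P⇒adjʳ p) uz (≢-sym z≢s)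
    ... | h , r = h , from (tail⇔ d p h) (P⇒Dˡ r)
    no′ : ∃ (Tail a) → ∃ λ z → u ~ z × z ≢ centre a
    no′ (h , t) with to (tail⇔ d p h) t
    ... | z , r = z , adj-sym G (P⇒adj r) , P⇒≢ r

  tails⇒twins : ∀ {a b} → E H q a → E H q b → Tail a ≐ Tail b → Twins H a b
  tails⇒twins qa qb t h with h ≟V q
  ... | yes refl = mk⇔ (λ _ → E-sym qb) (λ _ → E-sym qa)
  ... | no h≢q   = mk⇔ (λ e → proj₁ (to (t h) (e , h≢q))) (λ e → proj₁ (from (t h) (e , h≢q)))

  untwinned⇒tails≢ : ∀ {a b} → Untwinned a → E H q b → b ≢ a → ¬ (Tail a ≐ Tail b)
  untwinned⇒tails≢ (qa , lone) qb b≢a t = lone b≢a (tails⇒twins qa qb t)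

  Same : V H → V H → Set
  Same a b = centre a ≡ centre b

  same-side : ∀ {a b} → E H q a → E H q b → Same a b → a ≢ b →
              ∃ λ u → ∃ λ u′ → let s = centre a in
              D c s q × P c s u a × P c s u′ b × u ≢ u′
  same-side {a} {b} qa qb same a≢b with locate qa | locate qb
  ... | u , d , p | u′ , _ , p′ with subst (λ s → P c s u′ b) (sym same) p′
  ... | p″ = u , u′ , d , p , p″ , λ { refl → a≢b (unique p p″) }

  same⇒link : ∀ {a b} → E H q a → E H q b → Same a b → a ≢ b → ∃ λ r → Link a b r × Same r a
  same⇒link qa qb same a≢b with same-side qa qb same a≢b
  ... | u , u′ , d , p , p′ , u≢u′ with path (adj-sym G (P⇒adjʳ p)) (P⇒adjʳ p′) u≢u′
  ... | r , pr = r , link , centre-D (P⇒D pr)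
    where
    link : Link _ _ r
    link = ≐-trans (neighbour⇔ pr) λ h →
      mk⇔ (map (from (tail⇔ d p h)) (from (tail⇔ d p′ h)))
          (map (to (tail⇔ d p h)) (to (tail⇔ d p′ h)))

  -- For a = c - s - u and b = c - s - u′, equal tails mean equal darts at u and u′. Either these
  -- are nonempty and u is u′, or u and u′ are leaves at s.
  twins⇒not-same : ∀ {a b} → E H q a → E H q b → a ≢ b → Twins H a b → ¬ Same a b
  twins⇒not-same qa qb a≢b tw same with same-side qa qb same a≢b
  ... | u , u′ , d , p , p′ , u≢u′ =
    u≢u′ (leaf-unique (P⇒adjʳ p) (P⇒adjʳ p′)
           (λ (h , e) → u≢u′ (center-unique e (to (darts h) e)))
           (λ (h , e) → u≢u′ (center-unique (from (darts h) e) e)))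
    where
    darts : D u _ ≐ D u′ _
    darts = ≐-trans (≐-sym (tail⇔ d p)) (≐-trans (twins⇒tails tw) (tail⇔ d p′))

  -- The far end w of the tail of a. An empty tail has every w carrying a leaf g as far end.
  record Far (a : V H) (g w : Vertex G) : Set where
    constructor far
    field
      adj   : g ~ w
      off   : w ≢ centre a
      darts : D g w ≐ Tail a
  open Far

  -- The path h has centre g, and one of its ends is `centre a`, so w is the other.
  far-unique : ∀ {a h g w g′ w′} → E H q a → Tail a h → Far a g w → Far a g′ w′ → g ≡ g′ × w ≡ w′
  far-unique {a} {h} {g} {w} {g′} {w′} qa t f f′
    with center-unique (from (darts f h) t) (from (darts f′ h) t)
  ... | refl = refl , decidable-stable (w ≟ w′) λ w≢w′ → absurd w≢w′
    where
    absurd : w ≢ w′ → ⊥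
    absurd w≢w′ with locate qa
    ... | u , d , p = [ off f ∘ sym , off f′ ∘ sym ]′
      (end-cases (join (from (darts f h) t) (from (darts f′ h) t) w≢w′) (to (tail⇔ d p h) t))

  -- The neighbours of r = g - w - g′ fall into the darts g → w and g′ → w. A nonempty tail is a
  -- single thin path, so it fills one of these darts; as untwinned a and b have different tails,
  -- the other tail is the other dart, and not both tails are empty.
  link⇒far : ∀ {a b r} → Untwinned a → Untwinned b → ¬ Same a b → Link a b r →
             ∃ λ g → ∃ λ w → ∃ λ g′ → P g w g′ r × Far a g w × Far b g′ w
  link⇒far {a} {b} {r} ua ub apart l = by (tail? (proj₁ ua)) (tail? (proj₁ ub))
    where
    b≢a : b ≢ a
    b≢a refl = apart refl

    split : ∀ {a b g w g′ h} → Untwinned a → Untwinned b → b ≢ a → Link a b r →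
            P g w g′ r → Tail a h → D g w h → D g w ≐ Tail a × D g′ w ≐ Tail b
    split {a} {b} {g} {w} {g′} {h} ua ub b≢a l p t d = (λ e → mk⇔ (⇒ e) (⇐ e)) , λ e → mk⇔ (⇒′ e) (⇐′ e)
      where
      only : ∀ {e} → D g w e → e ≡ h
      only = tail-thin (proj₁ ua) t d
      ⇒ : ∀ e → D g w e → Tail a e
      ⇒ e d′ rewrite only d′ = t
      ⇐ : ∀ e → Tail a e → D g w e
      ⇐ e t′ rewrite tail-unique (proj₁ ua) t′ t = d
      ⇒′ : ∀ e → D g′ w e → Tail b e
      ⇒′ e d′ with to (l e) (D⇒E (P⇒D p) d′)
      ... | inj₂ t′ = t′
      ... | inj₁ t′ = ⊥-elim (P⇒≢ p (center-unique (⇐ e t′) d′))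
      ⇐′ : ∀ e → Tail b e → D g′ w e
      ⇐′ e t′ with neighbour p (from (l e) (inj₂ t′))
      ... | inj₂ d′ = d′
      ... | inj₁ d′ with only d′
      ... | refl = ⊥-elim (untwinned⇒tails≢ ua (proj₁ ub) b≢a λ f →
                     mk⇔ (λ x → subst (Tail b) (tail-unique (proj₁ ua) t x) t′)
                         (λ x → subst (Tail a) (tail-unique (proj₁ ub) t′ x) t))

    -- If g is c, the dart g → s contains q, which no tail does. Otherwise c - s - g is a neighbour
    -- of q with the tail of b but centred at s, hence a twin of b.
    unshared : ∀ {a b s g} → E H q a → Untwinned b → ¬ Same a b → centre a ≡ s →
               g ~ s → D g s ≐ Tail b → ⊥
    unshared {a} {b} {g = g} qa ub apart refl gs eq with locate qa | g ≟ c
    ... | u , d , p | yes refl = proj₂ (to (eq q) d) refl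
    ... | u , d , p | no g≢c with path (P⇒adj p) (adj-sym G gs) (≢-sym g≢c)
    ... | b̃ , p̃ = proj₂ ub (λ { refl → apart (sym (centre-D (P⇒D p̃))) })
                    (tails⇒twins (proj₁ ub) (D⇒E d (P⇒Dˡ p̃))
                      (≐-trans (≐-sym eq) (≐-sym (tail⇔ d p̃))))

    complete : ∀ {g w g′} → P g w g′ r → D g w ≐ Tail a × D g′ w ≐ Tail b →
               ∃ λ g → ∃ λ w → ∃ λ g′ → P g w g′ r × Far a g w × Far b g′ w
    complete {g} {w} {g′} p (ea , eb) = g , w , g′ , p ,
      far (P⇒adj p) (λ w≡s → unshared (proj₁ ua) ub apart (sym w≡s) (adj-sym G (P⇒adjʳ p)) eb) ea ,
      far (adj-sym G (P⇒adjʳ p))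
          (λ w≡t → unshared (proj₁ ub) ua (apart ∘ sym) (sym w≡t) (P⇒adj p) ea) eb

    by : Dec (∃ (Tail a)) → Dec (∃ (Tail b)) → _
    by (yes (h , t)) _ with view r
    ... | _ , _ , _ , p with neighbour p (from (l h) (inj₁ t))
    ... | inj₁ d = complete p (split ua ub b≢a l p t d)
    ... | inj₂ d = complete (flip p) (split ua ub b≢a l (flip p) t d)
    by (no _) (yes (h , t)) with view r
    ... | _ , _ , _ , p with neighbour p (from (l h) (inj₂ t))
    ... | inj₁ d = let (x , y) = split ub ua (≢-sym b≢a) (link-sym l) p t d
                   in complete (flip p) (y , x)
    ... | inj₂ d = let (x , y) = split ub ua (≢-sym b≢a) (link-sym l) (flip p) t d
                   in complete p (y , x)
    by (no ¬t) (no ¬t′) = ⊥-elim (untwinned⇒tails≢ ua (proj₁ ub) b≢a λ h →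
      mk⇔ (λ t → ⊥-elim (¬t (h , t))) (λ t → ⊥-elim (¬t′ (h , t))))

  -- If a and b were apart, each link would be a path g - w - g′. A nonempty tail determines w and
  -- its own end, and an end with empty tail is the only leaf at w, so the links would coincide.
  two-links⇒same : ∀ {a b} → Untwinned a → Untwinned b → TwoLinks a b → Same a b
  two-links⇒same {a} {b} ua ub (r , r′ , r≢r′ , l , l′) =
    decidable-stable (centre a ≟ centre b) λ apart →
      absurd apart (link⇒far ua ub apart l) (link⇒far ua ub apart l′)
    where
    absurd : ¬ Same a b →
             (∃ λ g → ∃ λ w → ∃ λ g′ → P g w g′ r × Far a g w × Far b g′ w) →
             (∃ λ g → ∃ λ w → ∃ λ g′ → P g w g′ r′ × Far a g w × Far b g′ w) → ⊥
    absurd apart (g₁ , w₁ , g₁′ , p₁ , fa₁ , fb₁) (g₂ , w₂ , g₂′ , p₂ , fa₂ , fb₂)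
      with tail? (proj₁ ua) | tail? (proj₁ ub)
    ... | no ¬t | no ¬t′ = untwinned⇒tails≢ ua (proj₁ ub) (λ { refl → apart refl }) λ h →
      mk⇔ (λ t → ⊥-elim (¬t (h , t))) (λ t → ⊥-elim (¬t′ (h , t)))
    ... | yes (_ , t) | yes (_ , t′)
      with far-unique (proj₁ ua) t fa₁ fa₂ | far-unique (proj₁ ub) t′ fb₁ fb₂
    ... | refl , refl | refl , _ = r≢r′ (unique p₁ p₂)
    absurd apart (g₁ , w₁ , g₁′ , p₁ , fa₁ , fb₁) (g₂ , w₂ , g₂′ , p₂ , fa₂ , fb₂)
      | yes (_ , t) | no ¬t′ with far-unique (proj₁ ua) t fa₁ fa₂
    ... | refl , refl with leaf-unique (adj-sym G (adj fb₁)) (adj-sym G (adj fb₂))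
                             (λ (h , d) → ¬t′ (h , to (darts fb₁ h) d))
                             (λ (h , d) → ¬t′ (h , to (darts fb₂ h) d))
    ... | refl = r≢r′ (unique p₁ p₂)
    absurd apart (g₁ , w₁ , g₁′ , p₁ , fa₁ , fb₁) (g₂ , w₂ , g₂′ , p₂ , fa₂ , fb₂)
      | no ¬t | yes (_ , t′) with far-unique (proj₁ ub) t′ fb₁ fb₂
    ... | refl , refl with leaf-unique (adj-sym G (adj fa₁)) (adj-sym G (adj fa₂))
                             (λ (h , d) → ¬t (h , to (darts fa₁ h) d))
                             (λ (h , d) → ¬t (h , to (darts fa₂ h) d))
    ... | refl = r≢r′ (unique p₁ p₂)

  -- One link is centred at the common centre of a and b, the other at the far end w.
  far⇒two-links : ∀ {a b g g′ w} → Untwinned a → E H q b → Same a b → a ≢ b →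
                  Far a g w → Far b g′ w → TwoLinks a b
  far⇒two-links {a} {b} {g} {g′} {w} ua qb same a≢b fa fb
    with same⇒link (proj₁ ua) qb same a≢b | path (adj fa) (adj-sym G (adj fb)) g≢g′
    where
    g≢g′ : g ≢ g′
    g≢g′ refl = untwinned⇒tails≢ ua qb (≢-sym a≢b) (≐-trans (≐-sym (darts fa)) (darts fb))
  ... | r , l , sr | r′ , p =
    r , r′ , (λ { refl → off fa (trans (sym (centre-D (P⇒D p))) sr) }) , l ,
    ≐-trans (neighbour⇔ p) λ h → mk⇔ (map (to (darts fa h)) (to (darts fb h)))
                                     (map (from (darts fa h)) (from (darts fb h)))

  -- The nonempty tail of n has only one far end, so a and b share it.
  apart-triple : ∀ {a b n r r′ h} → Untwinned a → Untwinned b → Untwinned n → a ≢ b →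
                 Same a b → ¬ Same a n → Link a n r → Link b n r′ → Tail n h → ¬ ¬ TwoLinks a b
  apart-triple ua ub un a≢b same apart l l′ t k
    with link⇒far ua un apart l | link⇒far ub un (apart ∘ trans same) l′
  ... | _ , _ , _ , _ , fa , fn | _ , _ , _ , _ , fb , fn′
    with far-unique (proj₁ un) t fn fn′
  ... | _ , refl = k (far⇒two-links ua (proj₁ ub) same a≢b fa fb)

-- Three bipartitions of the neighbours of a fork.

does⇒⇔ : {A B : Set} (A? : Dec A) (B? : Dec B) → does A? ≡ does B? → A ⇔ B
does⇒⇔ (yes a) (yes b) _ = mk⇔ (λ _ → b) (λ _ → a)
does⇒⇔ (no ¬a) (no ¬b) _ = mk⇔ (λ a → ⊥-elim (¬a a)) (λ b → ⊥-elim (¬b b))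

⇔⇒does : {A B : Set} (A? : Dec A) (B? : Dec B) → A ⇔ B → does A? ≡ does B?
⇔⇒does (yes _) (yes _) _ = refl
⇔⇒does (yes a) (no ¬b) e = ⊥-elim (¬b (to e a))
⇔⇒does (no ¬a) (yes b) e = ⊥-elim (¬a (from e b))
⇔⇒does (no _)  (no _)  _ = refl

xor-cancelˡ : ∀ x {y z} → x xor y ≡ x xor z → y ≡ z
xor-cancelˡ false e = e
xor-cancelˡ true  e = not-injective e

xor-cancelʳ : ∀ {x y} z → x xor z ≡ y xor z → x ≡ y
xor-cancelʳ {x} {y} z e =
  xor-cancelˡ z (trans (Bool.xor-comm z x) (trans e (Bool.xor-comm y z)))

≢-≢⇒≡ : {x y z : Bool} → x ≢ y → z ≢ x → z ≡ y
≢-≢⇒≡ x≢y z≢x = trans (¬-not z≢x) (sym (¬-not (≢-sym x≢y)))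

xor-≢ : ∀ {x y z w} → x ≢ z → y ≢ w → x xor y ≡ z xor w
xor-≢ {false} {y}     {false} n _ = ⊥-elim (n refl)
xor-≢ {true}  {y}     {true}  n _ = ⊥-elim (n refl)
xor-≢ {false} {y} {true}  {w} _ n = ¬-not n
xor-≢ {true}  {y} {false} {w} _ n = sym (¬-not (≢-sym n))

xor-via : ∀ x y z → y xor z ≡ (x xor y) xor (x xor z)
xor-via false y     z = refl
xor-via true  false z = sym (Bool.not-involutive z)
xor-via true  true  z = refl

-- What the combinatorics needs of the way a root of H distributes the neighbours of q over the
-- two ends of the path q.
record Sides (H : RawGraph) (q : V H) : Set where
  open Around H q
  field
    side   : V H → Bool
    link   : ∀ {a b} → Untwinned a → Untwinned b → a ≢ b → side a ≡ side b → ∃ (Link a b)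
    links  : ∀ {a b} → Untwinned a → Untwinned b → TwoLinks a b → side a ≡ side b
    triple : ∀ {a b n r r′ h} → Untwinned a → Untwinned b → Untwinned n → a ≢ b →
             side a ≡ side b → side a ≢ side n → Link a n r → Link b n r′ → Tail n h →
             ¬ ¬ TwoLinks a b

module ThreeSides {H : RawGraph} {q : V H}
  (tail-unless-twin : ∀ {a b} → Around.Untwinned H q a → Around.Untwinned H q b → a ≢ b →
                      ¬ ∃ (Around.Tail H q a) → ¬ ∃ (Around.Tail H q b) → ⊥) where
  open Around H q
  open Sides

  -- The bit β allows for exchanging the two ends of q.
  Differ : Sides H q → Sides H q → Set
  Differ S S′ = ∀ β → ¬ (∀ {a} → Untwinned a → side S a ≡ β xor side S′ a)

  differ-at : ∀ {S S′} → Differ S S′ → ∀ β →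
              ¬ ¬ ∃ λ a → Untwinned a × side S a xor side S′ a ≢ β
  differ-at {S} {S′} diff β k = diff β λ {a} ua → decidable-stable (_ Bool.≟ _) λ ne →
    k (a , ua , λ e → ne (xor-cancelʳ (side S′ a) (trans e (sym (twice β (side S′ a))))))
    where
    twice : ∀ x y → (x xor y) xor y ≡ x
    twice x y = trans (Bool.xor-assoc x y y)
                  (trans (cong (x xor_) (Bool.xor-same y)) (Bool.xor-identityʳ x))

  Lone : V H → V H → Set
  Lone a b = ∃ (Link a b) × ¬ TwoLinks a b

  lone-sym : ∀ {a b} → Lone a b → Lone b a
  lone-sym ((r , l) , n) = (r , link-sym l) ,
    λ (r , r′ , ne , l , l′) → n (r , r′ , ne , link-sym l , link-sym l′)

  -- One of S and S′ joins a and b, which gives a link; the other separates them, which rules out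
  -- two.
  disagree⇒lone : ∀ {a b} (S S′ : Sides H q) → Untwinned a → Untwinned b →
                  side S a xor side S′ a ≢ side S b xor side S′ b → Lone a b
  disagree⇒lone {a} {b} S S′ ua ub ne with side S a Bool.≟ side S b | side S′ a Bool.≟ side S′ b
  ... | yes e | yes e′ = ⊥-elim (ne (cong₂ _xor_ e e′))
  ... | yes e | no n′  = link S ua ub (λ { refl → ne refl }) e , n′ ∘ links S′ ua ub
  ... | no n  | yes e′ = link S′ ua ub (λ { refl → ne refl }) e′ , n ∘ links S ua ub
  ... | no n  | no n′  = ⊥-elim (ne (xor-≢ n n′))

  apart⇒no-tail : ∀ {a b n} (S : Sides H q) → Untwinned a → Untwinned b → Untwinned n →
                  Lone a b → Lone a n → Lone b n → a ≢ b →
                  side S a ≡ side S b → side S a ≢ side S n → ¬ ∃ (Tail n)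
  apart⇒no-tail S ua ub un (_ , one) ((_ , l) , _) ((_ , l′) , _) a≢b e n (_ , t) =
    triple S ua ub un a≢b e n l l′ t one

  -- On {a, b, n} the three bipartitions are pairwise different, so each of the three pairs has
  -- exactly one link, and two of the bipartitions cut off different elements of the triple.
  no-triple : ∀ (S S′ T : Sides H q) {a b n} → Untwinned a → Untwinned b → Untwinned n →
              side S a xor side S′ a ≡ side S b xor side S′ b →
              side S n xor side S′ n ≢ side S a xor side S′ a →
              side S a xor side T a ≢ side S b xor side T b → ⊥
  no-triple S S′ T {a} {b} {n} ua ub un concur ne-n ne-T =
    by (side S a Bool.≟ side S b)
    where
    a≢b : a ≢ b
    a≢b refl = ne-T refl
    n≢a : n ≢ a
    n≢a refl = ne-n refl
    n≢b : n ≢ b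
    n≢b refl = ne-n (sym concur)

    ab = disagree⇒lone S T ua ub ne-T
    na = disagree⇒lone S S′ un ua ne-n
    nb = disagree⇒lone S S′ un ub (λ e → ne-n (trans e (sym concur)))

    n-apart : ∀ X → side X a ≡ side X b → side X a ≢ side X n → ¬ ∃ (Tail n)
    n-apart X = apart⇒no-tail X ua ub un ab (lone-sym na) (lone-sym nb) a≢b
    a-apart : ∀ X → side X n ≡ side X b → side X n ≢ side X a → ¬ ∃ (Tail a)
    a-apart X = apart⇒no-tail X un ub ua nb na (lone-sym ab) n≢b
    b-apart : ∀ X → side X n ≡ side X a → side X n ≢ side X b → ¬ ∃ (Tail b)
    b-apart X = apart⇒no-tail X un ua ub na nb ab n≢a

    by : Dec (side S a ≡ side S b) → ⊥
    -- S and S′ join a and b while T separates them. One of S and S′ cuts off n, and T cuts off a or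
    -- b.
    by (yes e) = ends (side T n Bool.≟ side T a)
      where
      e′ : side S′ a ≡ side S′ b
      e′ = xor-cancelˡ (side S a) (trans concur (cong (_xor side S′ b) (sym e)))
      T-ne : side T a ≢ side T b
      T-ne f = ne-T (cong₂ _xor_ e f)
      n-empty : ¬ ∃ (Tail n)
      n-empty with side S a Bool.≟ side S n
      ... | no f  = n-apart S e f
      ... | yes f = n-apart S′ e′ λ f′ → ne-n (cong₂ _xor_ (sym f) (sym f′))
      ends : Dec (side T n ≡ side T a) → ⊥
      ends (yes f) = tail-unless-twin un ub n≢b n-empty (b-apart T f (λ g → T-ne (trans (sym f) g)))
      ends (no f)  = tail-unless-twin un ua n≢a n-empty (a-apart T (≢-≢⇒≡ T-ne f) f)
    -- S and S′ separate a and b but differ on n, so one of them cuts off a and the other b.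
    by (no ne) = tails (side S n Bool.≟ side S a)
      where
      ne′ : side S′ a ≢ side S′ b
      ne′ f = ne (xor-cancelʳ (side S′ b) (trans (cong (side S a xor_) (sym f)) concur))
      tails : Dec (side S n ≡ side S a) → ⊥
      tails (yes f) = tail-unless-twin ua ub a≢b (a-apart S′ (≢-≢⇒≡ ne′ f′) f′)
                        (b-apart S f (λ g → ne (trans (sym f) g)))
        where
        f′ : side S′ n ≢ side S′ a
        f′ g = ne-n (cong₂ _xor_ f g)
      tails (no f) = tail-unless-twin ua ub a≢b (a-apart S g f)
                       (b-apart S′ g′ (λ h → ne′ (trans (sym g′) h)))
        where
        g : side S n ≡ side S b
        g = ≢-≢⇒≡ ne f
        g′ : side S′ n ≡ side S′ a
        g′ = ≢-≢⇒≡ (≢-sym ne′) λ h → ne-n (trans (cong₂ _xor_ g h) (sym concur))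

  -- Choose a and b with different values of S₁ xor S₂. The three pairwise sums cancel, so S₁ xor S₃
  -- or S₂ xor S₃ takes equal values at a and b; with an n where it takes another value, `no-triple`
  -- applies.
  two-concur : ∀ {S₁ S₂ S₃} → Differ S₁ S₂ → Differ S₁ S₃ → Differ S₂ S₃ → ⊥
  two-concur {S₁} {S₂} {S₃} d₁₂ d₁₃ d₂₃ =
    differ-at {S₁} {S₂} d₁₂ false λ (a , ua , _) →
    differ-at {S₁} {S₂} d₁₂ (side S₁ a xor side S₂ a) λ (b , ub , ne) →
    by ua ub (≢-sym ne) (side S₁ a xor side S₃ a Bool.≟ side S₁ b xor side S₃ b)
    where
    by : ∀ {a b} → Untwinned a → Untwinned b →
         side S₁ a xor side S₂ a ≢ side S₁ b xor side S₂ b →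
         Dec (side S₁ a xor side S₃ a ≡ side S₁ b xor side S₃ b) → ⊥
    by {a} ua ub ne (yes e) = differ-at {S₁} {S₃} d₁₃ (side S₁ a xor side S₃ a) λ (n , un , ne-n) →
      no-triple S₁ S₃ S₂ ua ub un e ne-n ne
    by {a} {b} ua ub ne (no ne′) = differ-at {S₂} {S₃} d₂₃ (side S₂ a xor side S₃ a) λ (n , un , ne-n) →
      no-triple S₂ S₃ S₁ ua ub un
        (trans (xor-via (side S₁ a) (side S₂ a) (side S₃ a))
          (trans (xor-≢ ne ne′) (sym (xor-via (side S₁ b) (side S₂ b) (side S₃ b)))))
        ne-n
        (λ e → ne (trans (Bool.xor-comm (side S₁ a) _) (trans e (Bool.xor-comm (side S₂ b) _))))

-- Matching bipartitions at a fork yield agreement.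

Light : ∀ {H} → NoIsolated H → Graph → Set₁
Light {H} noIsolated G = (R : Root H G) → ¬ Heavy.HeavyEdge noIsolated R

module AtFork {H : RawGraph} (noIsolated : NoIsolated H) {q : V H} (fork : ThreeNeighbours H q)
              (few : ∀ {m} → E H q m → ¬ ThreeNeighbours H m) where
  open Around H q

  module Rooted {G : Graph} (light : Light noIsolated G) (R : Root H G)
                {x c y : Vertex G} (xcy : Root.P R x c y q) where
    open RootProperties R

    thin : Thin R q
    thin = ThinPaths.three⇒thin R noIsolated (light R) fork

    open Local noIsolated R q thin few using (Same; centre-D) public
    private module L = Local noIsolated R q thin few

    side : V H → Bool
    side a = does (D-dec x c a)

    Dx⇔ : ∀ {a} → E H q a → D x c a ⇔ (¬ D y c a)
    Dx⇔ {a} qa = mk⇔ (λ d d′ → P⇒≢ xcy (center-unique d d′))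
                     (λ ¬d → [ id , (λ d → ⊥-elim (¬d d)) ]′ (neighbour xcy qa))

    same⇔ : ∀ {a b} → E H q a → E H q b → Same a b ⇔ (D x c a ⇔ D x c b)
    same⇔ {a} {b} qa qb = mk⇔ ⇒ ⇐
      where
      move : ∀ {a b} → E H q b → Same a b → D x c a → D x c b
      move qb s d with neighbour xcy qb
      ... | inj₁ d′ = d′
      ... | inj₂ d′ = ⊥-elim (P⇒≢ xcy (trans (sym (centre-D d)) (trans s (centre-D d′))))
      ⇒ : Same a b → _
      ⇒ s = mk⇔ (move qb s) (move qa (sym s))
      ⇐ : D x c a ⇔ D x c b → Same a b
      ⇐ e with neighbour xcy qa | neighbour xcy qb
      ... | inj₁ d | _      = trans (centre-D d) (sym (centre-D (to e d)))
      ... | inj₂ _ | inj₁ d = trans (centre-D (from e d)) (sym (centre-D d))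
      ... | inj₂ d | inj₂ d′ = trans (centre-D d) (sym (centre-D d′))

    same⇔side : ∀ {a b} → E H q a → E H q b → Same a b ⇔ (side a ≡ side b)
    same⇔side {a} {b} qa qb = mk⇔ (⇔⇒does (D-dec x c a) (D-dec x c b) ∘ to (same⇔ qa qb))
                                  (from (same⇔ qa qb) ∘ does⇒⇔ (D-dec x c a) (D-dec x c b))

    twins-apart : ∀ {a b} → E H q a → E H q b → a ≢ b → Twins H a b → D x c a → ¬ D x c b
    twins-apart qa qb a≢b tw d d′ =
      L.twins⇒not-same qa qb a≢b tw (trans (centre-D d) (sym (centre-D d′)))

    sides : Sides H q
    sides = record
      { side   = side
      ; link   = λ (qa , _) (qb , _) a≢b e →
                   let (r , l , _) = L.same⇒link qa qb (from (same⇔side qa qb) e) a≢b in r , l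
      ; links  = λ ua ub two → to (same⇔side (proj₁ ua) (proj₁ ub)) (L.two-links⇒same ua ub two)
      ; triple = λ ua ub un a≢b e n → L.apart-triple ua ub un a≢b
                   (from (same⇔side (proj₁ ua) (proj₁ ub)) e)
                   (n ∘ to (same⇔side (proj₁ ua) (proj₁ un)))
      }

    tail-unless-twin : ∀ {a b} → Untwinned a → Untwinned b → a ≢ b →
                       ¬ ∃ (Tail a) → ¬ ∃ (Tail b) → ⊥
    tail-unless-twin ua ub a≢b ¬t ¬t′ = L.untwinned⇒tails≢ ua (proj₁ ub) (≢-sym a≢b) λ h →
      mk⇔ (λ t → ⊥-elim (¬t (h , t))) (λ t → ⊥-elim (¬t′ (h , t)))

  -- Sides that match at the untwinned neighbours of q can be made to match at all: a mismatched
  -- neighbour has a twin on the other side, and the two are exchanged.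
  module Repair {G G′ : Graph} (light : Light noIsolated G) (light′ : Light noIsolated G′)
                (R : Root H G) {x c y : Vertex G} (xcy : Root.P R x c y q)
                {x′ c′ y′ : Vertex G′} where
    private
      module R = RootProperties R
      module L = Rooted light R xcy

    record State : Set₁ where
      field
        target : Root H G′
        xcy′   : Root.P target x′ c′ y′ q
      module R′ = RootProperties target
      Right : V H → Set
      Right a = R.D x c a ⇔ R′.D x′ c′ a
      field
        lone   : ∀ {a} → Untwinned a → Right a
    open State using (target; xcy′; lone; Right)

    record _≼_ (S₁ S₂ : State) : Set where
      constructor preserving
      field preserve : ∀ {a} → E H q a → Right S₁ a → Right S₂ a
    open _≼_

    right? : ∀ S a → Dec (Right S a)
    right? S a with R.D-dec x c a | RootProperties.D-dec (target S) x′ c′ a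
    ... | yes d | yes d′ = yes (mk⇔ (λ _ → d′) (λ _ → d))
    ... | yes d | no ¬d′ = no λ e → ¬d′ (to e d)
    ... | no ¬d | yes d′ = no λ e → ¬d (from e d′)
    ... | no ¬d | no ¬d′ = yes (mk⇔ (⊥-elim ∘ ¬d) (⊥-elim ∘ ¬d′))

    module Step (S : State) {a b : V H} (qa : E H q a) (d : R.D x c a) (wrong : ¬ Right S a)
                (b≢a : b ≢ a) (tw : Twins H a b) where
      private
        module R′ = RootProperties (target S)
        module L′ = Rooted light′ (target S) (xcy′ S)
      open TwinSwap (target S) tw

      qb : E H q b
      qb = R.E-sym (to (tw q) (R.E-sym qa))

      ¬db : ¬ R.D x c b
      ¬db = L.twins-apart qa qb (≢-sym b≢a) tw d

      ¬d′a : ¬ R′.D x′ c′ a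
      ¬d′a d′ = wrong (mk⇔ (λ _ → d′) (λ _ → d))

      d′b : R′.D x′ c′ b
      d′b = from (L′.Dx⇔ qb) λ e →
        Rooted.twins-apart light′ (target S) (R′.flip (xcy′ S)) qa qb (≢-sym b≢a) tw
          ([ ⊥-elim ∘ ¬d′a , id ]′ (R′.neighbour (xcy′ S) qa)) e

      right-a : R.D x c a ⇔ S.D x′ c′ a
      right-a = mk⇔ (λ _ → subst (R′.D x′ c′) (sym transpose-s) d′b) (λ _ → d)

      right-b : R.D x c b ⇔ S.D x′ c′ b
      right-b = mk⇔ (⊥-elim ∘ ¬db) (⊥-elim ∘ ¬d′a ∘ subst (R′.D x′ c′) transpose-t)

      kept : ∀ {e} → R.D x c e ⇔ R′.D x′ c′ e → R.D x c e ⇔ S.D x′ c′ e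
      kept {e} r with transpose-cases e
      ... | inj₁ (refl , _)          = right-a
      ... | inj₂ (inj₁ (refl , _))   = right-b
      ... | inj₂ (inj₂ (_ , _ , eq)) =
        mk⇔ (subst (R′.D x′ c′) (sym eq) ∘ to r) (from r ∘ subst (R′.D x′ c′) eq)

      next : State
      next = record
        { target = swapped
        -- Both twins are adjacent to q, so the swap leaves q in place.
        ; xcy′ = subst (R′.P x′ c′ y′) (sym (transpose-other (R.E⇒≢ qa) (R.E⇒≢ qb))) (xcy′ S)
        ; lone = λ u → kept (lone S u) }

    Fixed : Vertex G → State → Set
    Fixed u S = ∀ {a} → R.P c x u a → Right S a

    fix : ∀ u S → ¬ ¬ (Σ State λ S′ → S ≼ S′ × Fixed u S′)
    fix u S k with T? (Graph.adj G x u) | u ≟ c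
    ... | no ¬xu | _       = k (S , preserving (λ _ → id) , λ p → ⊥-elim (¬xu (R.P⇒adjʳ p)))
    ... | yes _  | yes u≡c = k (S , preserving (λ _ → id) , λ p → ⊥-elim (R.P⇒≢ p (sym u≡c)))
    ... | yes xu | no u≢c with R.path (adj-sym G (R.P⇒adj xcy)) xu (≢-sym u≢c)
    ... | a , p with right? S a
    ... | yes r    = k (S , preserving (λ _ → id) , λ p′ → subst (Right S) (R.unique p p′) r)
    ... | no wrong = wrong (lone S (qa , λ b≢a tw →
            ⊥-elim (k (step b≢a tw))))
      where
      qa : E H q a
      qa = R.D⇒E (R.P⇒Dˡ xcy) (R.P⇒Dˡ p)
      step : ∀ {b} → b ≢ a → Twins H a b → Σ State λ S′ → S ≼ S′ × Fixed u S′
      step b≢a tw = next , preserving (λ _ → kept) ,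
                    λ p′ → subst (Right next) (R.unique p p′) right-a
        where open Step S qa (R.P⇒Dˡ p) wrong b≢a tw

    agree : ∀ S → ¬ ¬ (Σ (Root H G′) λ R′ → Agree R R′)
    agree S₀ k =
      sweep _≼_ (λ _ → preserving λ _ → id)
            (λ l m → preserving λ qa → preserve m qa ∘ preserve l qa)
            Fixed (λ l f {a} p → preserve l (R.D⇒E (R.P⇒Dˡ xcy) (R.P⇒Dˡ p)) (f p)) fix S₀
            λ (S , _ , fixed) → k (target S , finish S fixed)
      where
      finish : ∀ S → (∀ u → Fixed u S) → Agree R (target S)
      finish S fixed = x , c , x′ , c′ ,
        edgeAgree (R.P⇒adj xcy) (R′.P⇒adj (xcy′ S)) outer inner (inj₂ (q , R.P⇒Dˡ xcy))
        where
        module R′ = RootProperties (target S)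
        module L′ = Rooted light′ (target S) (xcy′ S)
        -- If a is not centred at x, then a twin of a would be, and so would be centred at x′ along
        -- with a. Hence a is untwinned.
        ⇐ : ∀ a → R′.D x′ c′ a → R.D x c a
        ⇐ a d′ = decidable-stable (R.D-dec x c a) λ ¬d →
          let qa = R′.D⇒E (R′.P⇒Dˡ (xcy′ S)) d′ in
          ¬d (from (lone S (qa , λ {b} b≢a tw →
            let qb = R.E-sym (to (tw q) (R.E-sym qa))
                db = from (L.Dx⇔ qb) λ e → Rooted.twins-apart light R (R.flip xcy) qa qb
                       (≢-sym b≢a) tw ([ ⊥-elim ∘ ¬d , id ]′ (R.neighbour xcy qa)) e
            in L′.twins-apart qa qb (≢-sym b≢a) tw d′ (to (fixed _ (R.flip (proj₂ db))) db))) d′)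
        outer : R.D x c ≐ R′.D x′ c′
        outer a = mk⇔ (λ d → to (fixed _ (R.flip (proj₂ d))) d) (⇐ a)
        inner : R.D c x ≐ R′.D c′ x′
        inner h = mk⇔ (λ d → subst (R′.D c′ x′) (sym (L.thin (R.P⇒Dˡ xcy) d)) (R′.P⇒Dˡ (xcy′ S)))
                      (λ d → subst (R.D c x) (sym (L′.thin (R′.P⇒Dˡ (xcy′ S)) d)) (R.P⇒Dˡ xcy))

  module _ {G G′ : Graph} (light : Light noIsolated G) (light′ : Light noIsolated G′)
           (conflict : Conflict H G G′) (R : Root H G) (R′ : Root H G′)
           {x c y : Vertex G} (xcy : Root.P R x c y q)
           {x′ c′ y′ : Vertex G′} (xcy′ : Root.P R′ x′ c′ y′ q) where
    private
      module R  = RootProperties R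
      module R′ = RootProperties R′
      module L′ = Rooted light′ R′ xcy′

    -- Bipartitions that match up to exchanging the ends of q would give agreement; for β = `true`,
    -- the path q is read backwards in R′.
    sides-differ : ∀ β → ¬ (∀ {a} → Untwinned a →
                   Rooted.side light R xcy a ≡ β xor Rooted.side light′ R′ xcy′ a)
    sides-differ false eq =
      Repair.agree light light′ R xcy
        (record { target = R′ ; xcy′ = xcy′
                ; lone = λ {a} u → does⇒⇔ (R.D-dec x c a) (R′.D-dec x′ c′ a) (eq u) })
        λ (R″ , a) → conflict R R″ a
    sides-differ true eq =
      Repair.agree light light′ R xcy
        (record { target = R′ ; xcy′ = R′.flip xcy′
                ; lone = λ {a} u → let e = L′.Dx⇔ (proj₁ u)
                                       f = does⇒⇔ (R.D-dec x c a) (¬? (R′.D-dec x′ c′ a)) (eq u)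
                                   in mk⇔ (λ d → decidable-stable (R′.D-dec y′ c′ a) (to f d ∘ from e))
                                          (λ d → from f λ d′ → to e d′ d) })
        λ (R″ , a) → conflict R R″ a

no-fork : ∀ {H G₁ G₂ G₃} (noIsolated : NoIsolated H) → Root H G₁ → Root H G₂ → Root H G₃ →
          Light noIsolated G₁ → Light noIsolated G₂ → Light noIsolated G₃ →
          Conflict H G₁ G₂ → Conflict H G₁ G₃ → Conflict H G₂ G₃ → ∀ {q} → ¬ ThreeNeighbours H q
no-fork {H} noIsolated R₁ R₂ R₃ l₁ l₂ l₃ c₁₂ c₁₃ c₂₃ {q} fork =
  ThreeSides.two-concur (Rooted.tail-unless-twin l₁ R₁ p₁)
    {Rooted.sides l₁ R₁ p₁} {Rooted.sides l₂ R₂ p₂} {Rooted.sides l₃ R₃ p₃}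
    (sides-differ l₁ l₂ c₁₂ R₁ R₂ p₁ p₂)
    (sides-differ l₁ l₃ c₁₃ R₁ R₃ p₁ p₃)
    (sides-differ l₂ l₃ c₂₃ R₂ R₃ p₂ p₃)
  where
  -- Two adjacent forks would be thin in both R₁ and R₂.
  few : ∀ {m} → E H q m → ¬ ThreeNeighbours H m
  few e fork′ = c₁₂ R₁ R₂ (thin⇒agree R₁ R₂ e
    (ThinPaths.three⇒thin R₁ noIsolated (l₁ R₁) fork)
    (ThinPaths.three⇒thin R₁ noIsolated (l₁ R₁) fork′)
    (ThinPaths.three⇒thin R₂ noIsolated (l₂ R₂) fork)
    (ThinPaths.three⇒thin R₂ noIsolated (l₂ R₂) fork′))
  open AtFork noIsolated fork few
  p₁ = proj₂ (proj₂ (proj₂ (Root.view R₁ q)))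
  p₂ = proj₂ (proj₂ (proj₂ (Root.view R₂ q)))
  p₃ = proj₂ (proj₂ (proj₂ (Root.view R₃ q)))

-- H of maximum degree at most two.

module Hexagon {H : RawGraph} (conn : Connected H) (E-sym : ∀ {h k} → E H h k → E H k h)
               (_≟V_ : (h k : V H) → Dec (h ≡ k))
               (no-fork : ∀ {h} → ¬ ThreeNeighbours H h)
               (corner : Fin 6 → V H) (corner-injective : ∀ {i j} → corner i ≡ corner j → i ≡ j)
               where
  next prev antipode : Fin 6 → Fin 6
  next 0F = 1F
  next 1F = 2F
  next 2F = 3F
  next 3F = 4F
  next 4F = 5F
  next 5F = 0F
  prev = next ∘ next ∘ next ∘ next ∘ next
  antipode = next ∘ next ∘ next

  next-prev : ∀ i → next (prev i) ≡ i
  next-prev = from-yes (all? λ i → next (prev i) ≟ i)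

  next≢prev : ∀ i → next i ≢ prev i
  next≢prev = from-yes (all? λ i → ¬? (next i ≟ prev i))

  module _ (side : ∀ i → E H (corner i) (corner (next i))) where
    side⁻ : ∀ i → E H (corner i) (corner (prev i))
    side⁻ i = E-sym (subst (λ j → E H (corner (prev i)) (corner j)) (next-prev i) (side (prev i)))

    neighbours : ∀ i {k} → E H (corner i) k → k ≡ corner (next i) ⊎ k ≡ corner (prev i)
    neighbours i {k} e with k ≟V corner (next i) | k ≟V corner (prev i)
    ... | yes p | _     = inj₁ p
    ... | no _  | yes p = inj₂ p
    ... | no n  | no n′ = ⊥-elim (no-fork
      (three e (side i) (side⁻ i) n n′ (next≢prev i ∘ corner-injective)))

    -- Each corner has its two neighbours on the hexagon and no third one, so a walk in H never
    -- leaves it.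
    cover : ∀ h → ∃ λ i → corner i ≡ h
    cover h = walk 0F (proj₂ conn (corner 0F) h)
      where
      walk : ∀ i {h} → Star (E H) (corner i) h → ∃ λ j → corner j ≡ h
      walk i ε = i , refl
      walk i (e ◅ es) with neighbours i e
      ... | inj₁ refl = walk (next i) es
      ... | inj₂ refl = walk (prev i) es

    opposite : V H → V H
    opposite h = corner (antipode (proj₁ (cover h)))

    opposite-corner : ∀ i → opposite (corner i) ≡ corner (antipode i)
    opposite-corner i = cong (corner ∘ antipode) (corner-injective (proj₂ (cover (corner i))))

    opposite-invol : ∀ h → opposite (opposite h) ≡ h
    opposite-invol h = trans (opposite-corner _)
      (trans (cong corner (from-yes (all? λ i → antipode (antipode i) ≟ i) _)) (proj₂ (cover h)))

    opposite-E : ∀ {h k} → E H h k → E H (opposite h) (opposite k)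
    opposite-E {h} {k} e with cover h
    ... | i , refl with neighbours i e
    ... | inj₁ refl rewrite opposite-corner (next i) = side (antipode i)
    ... | inj₂ refl rewrite opposite-corner (prev i) = side⁻ (antipode i)

module Arms {H : RawGraph} (conn : Connected H) (noIsolated : NoIsolated H)
            (no-fork : ∀ {h} → ¬ ThreeNeighbours H h) where

  -- Some vertex of the root has degree at least three.
  Fat : ∀ {G} → Root H G → Set
  Fat R = ∃ λ b → ∃ λ c → ∃ λ h → ∃ λ h′ →
          h ≢ h′ × RootProperties.D R b c h × RootProperties.D R b c h′

  -- q is the only path turning from c to a fat vertex b, and p, p′ are its neighbours, centred at b.
  record Arm {G} (R : Root H G) (q p p′ : V H) : Set where
    constructor arm
    open RootProperties R
    field
      {b c} : Vertex G
      bc    : D b c p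
      bc′   : D b c p′
      cb    : D c b q
      p≢p′  : p ≢ p′

  module _ {G} (light : Light noIsolated G) (R : Root H G) where
    open RootProperties R

    lean⇒thin : ¬ Fat R → ∀ h → Thin R h
    lean⇒thin lean h with view h
    ... | _ , b , c , p = ThinPaths.dart-unique⇒thin R (P⇒D p) λ {k} d →
      decidable-stable (k ≟V h) λ ne → lean (b , c , k , h , ne , d , P⇒D p)

    -- The neighbours u and c of b are not both leaves; the one with a further neighbour carries an
    -- arm.
    fat⇒arm : Fat R → ¬ ¬ ∃ λ q → ∃ λ p → ∃ λ p′ → Arm R q p p′
    fat⇒arm (b , c , h , h′ , n , (u , p) , (v , p′)) k =
      P⇒≢ p (Leaves.leaf-unique R noIsolated (adj-sym G (P⇒adj p)) (P⇒adjʳ p)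
        (λ (q , d) → k (q , h , _ , arm (P⇒Dˡ p) (P⇒Dˡ (proj₂ r)) d
          λ e → P⇒≢ p′ (sym (other-end p (subst (P u b v) (sym e) (proj₂ r))))))
        (λ (q , d) → k (q , h , h′ , arm (P⇒D p) (P⇒D p′) d n)))
      where
      r : ∃ (P u b v)
      r = path (P⇒adj p) (adj-sym G (P⇒adj p′)) λ { refl → n (unique p p′) }

    module _ {q p p′} (A : Arm R q p p′) where
      open Arm A

      arm-swap : Arm R q p′ p
      arm-swap = arm bc′ bc cb (≢-sym p≢p′)

      arm-thin : Thin R q
      arm-thin = ThinPaths.light⇒thin R noIsolated (light R) bc bc′ p≢p′ cb

      arm-neighbours : ∀ {k} → E H q k → k ≡ p ⊎ k ≡ p′
      arm-neighbours {k} e with k ≟V p | k ≟V p′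
      ... | yes x | _     = inj₁ x
      ... | no _  | yes x = inj₂ x
      ... | no n  | no n′ = ⊥-elim (no-fork (three e (D⇒E cb bc) (D⇒E cb bc′) n n′ p≢p′))

      arm-dart : D b c ≐ E H q
      arm-dart k = mk⇔ (D⇒E cb) λ e → [ (λ { refl → bc }) , (λ { refl → bc′ }) ]′ (arm-neighbours e)

    OnArm : V H → Set
    OnArm h = (∃ λ p → ∃ λ p′ → Arm R h p p′) ⊎ (∃ λ q → ∃ λ p′ → Arm R q h p′)

    -- A neighbour of u - b - c that is centred at c is q by thinness; one centred at u is the tip
    -- of the arm from b towards u.
    on-arm-step : ∀ {h k} → E H h k → OnArm h → OnArm k
    on-arm-step e (inj₁ (p , p′ , A)) with arm-neighbours A e
    ... | inj₁ refl = inj₂ (_ , _ , A)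
    ... | inj₂ refl = inj₂ (_ , _ , arm-swap A)
    on-arm-step {h} e (inj₂ (q , p′ , A@(arm {b} {c} (u , pu) (v , pv) cb n))) with neighbour pu e
    ... | inj₂ d with arm-thin A cb d
    ... | refl = inj₁ (_ , _ , A)
    on-arm-step {h} e (inj₂ (q , p′ , arm {b} {c} (u , pu) (v , pv) cb n)) | inj₁ d
      with path (P⇒adj pu) (adj-sym G (P⇒adj pv)) (λ { refl → n (unique pu pv) })
    ... | r , pr = inj₁ (h , r , arm (P⇒Dˡ pu) (P⇒Dˡ pr) d
                           λ { refl → P⇒≢ pv (sym (other-end pu pr)) })

    all-on-arm : ∀ {q p p′} → Arm R q p p′ → ∀ h → OnArm h
    all-on-arm A h = walk (proj₂ conn _ h) (inj₁ (_ , _ , A))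
      where
      walk : ∀ {h k} → Star (E H) h k → OnArm h → OnArm k
      walk ε        x = x
      walk (e ◅ es) x = walk es (on-arm-step e x)

  module _ {G G′} (light : Light noIsolated G) (light′ : Light noIsolated G′) (R : Root H G) where
    private module R = RootProperties R

    -- The darts of b c are the neighbourhood of q and q alone, both read off from H.
    arms⇒agree : ∀ {q p p′ r r′} (R′ : Root H G′) → Arm R q p p′ → Arm R′ q r r′ → Agree R R′
    arms⇒agree {q} R′ A A′ = _ , _ , _ , _ , Agreement.darts⇒edge R R′ A.bc A.cb
      (≐-trans (arm-dart light R A) (≐-sym (arm-dart light′ R′ A′)))
      (λ k → mk⇔ (λ d → subst (R′.D _ _) (sym (arm-thin light R A A.cb d)) A′.cb)
                 (λ d → subst (R.D _ _) (sym (arm-thin light′ R′ A′ A′.cb d)) A.cb))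
      where
      module R′ = RootProperties R′
      module A = Arm A
      module A′ = Arm A′

    -- H is a hexagon in which R and R′ have opposite ideas of which corners are centred at the
    -- fat vertex; the antipodal map reconciles them.
    hexagon⇒agree : ∀ {q p p′} (R′ : Root H G′) → Arm R q p p′ → ∀ {α β γ c} →
                    Root.P R′ α c β q → Adj G′ c γ → γ ≢ α → γ ≢ β →
                    RootProperties.D R′ α c p → RootProperties.D R′ β c p′ →
                    Σ (Root H G′) (Agree R)
    hexagon⇒agree {q} {p} {p′} R′ A@(arm {b} {c₁} (u , pu) (v , pv) cb n) {α} {β} {γ} {c}
                  pq cγ γ≢α γ≢β dp dp′ =
      R″ , arms⇒agree R″ A
        -- Corners 0, 1 and 5 are q, p and p′; their antipodes r, k₃ and k₂ lie on the edge c γ.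
        (arm {b = c} {c = γ}
          (subst (R′.D c γ) (sym (opposite-corner side 1F)) (R′.P⇒D p₃))
          (subst (R′.D c γ) (sym (opposite-corner side 5F)) (R′.P⇒D p₂))
          (subst (R′.D γ c) (sym (opposite-corner side 0F)) dr) n)
      where
      module R′ = RootProperties R′
      c~α = adj-sym G′ (R′.P⇒adj pq)
      c~β = R′.P⇒adjʳ pq
      k₂,p₂ = R′.path (adj-sym G′ c~α) cγ (≢-sym γ≢α)
      k₃,p₃ = R′.path (adj-sym G′ c~β) cγ (≢-sym γ≢β)
      k₂ = proj₁ k₂,p₂
      k₃ = proj₁ k₃,p₃
      p₂ = proj₂ k₂,p₂
      p₃ = proj₂ k₃,p₃
      r,pr = R.path (R.P⇒adj pu) (adj-sym G (R.P⇒adj pv)) λ { refl → n (R.unique pu pv) }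
      r = proj₁ r,pr
      pr = proj₂ r,pr

      q≢k₂ : q ≢ k₂
      q≢k₂ e = γ≢β (sym (R′.other-end pq (subst (R′.P α c γ) (sym e) p₂)))
      q≢k₃ : q ≢ k₃
      q≢k₃ e = γ≢α (sym (R′.other-end (R′.flip pq) (subst (R′.P β c γ) (sym e) p₃)))
      k₂≢k₃ : k₂ ≢ k₃
      k₂≢k₃ e = R′.P⇒≢ pq (R′.other-end (R′.flip p₂) (R′.flip (subst (R′.P β c γ) (sym e) p₃)))

      qp : E H q p
      qp = R.D⇒E cb (R.P⇒D pu)
      qp′ : E H q p′
      qp′ = R.D⇒E cb (R.P⇒D pv)
      pk₂ : E H p k₂
      pk₂ = R′.D⇒E dp (R′.P⇒Dˡ p₂)
      p′k₃ : E H p′ k₃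
      p′k₃ = R′.D⇒E dp′ (R′.P⇒Dˡ p₃)

      beyond : ∀ {w p k} → R.P w b c₁ p → E H p k → q ≢ k → R.D w b k
      beyond pw e q≢k with R.neighbour pw e
      ... | inj₁ d = d
      ... | inj₂ d = ⊥-elim (q≢k (sym (arm-thin light R A cb d)))

      k₂r : E H k₂ r
      k₂r = R.D⇒E (beyond pu pk₂ q≢k₂) (R.P⇒Dˡ pr)
      k₃r : E H k₃ r
      k₃r = R.D⇒E (beyond pv p′k₃ q≢k₃) (R.P⇒D pr)
      dr : R′.D γ c r
      dr = R′.common-neighbour (R′.P⇒D p₂) (R′.P⇒D p₃) k₂≢k₃ k₂r k₃r

      apart : ∀ {a e a′ e′ h k} → R′.D a e h → R′.D a′ e′ k → a ≢ a′ → h ≢ k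
      apart d d′ a≢a′ refl = a≢a′ (R′.center-unique d d′)
      c≢α = adj⇒≢ G′ c~α
      c≢β = adj⇒≢ G′ c~β
      c≢γ = adj⇒≢ G′ cγ
      dq = R′.P⇒D pq
      d₂ = R′.P⇒D p₂
      d₃ = R′.P⇒D p₃

      corners : Vec (V H) 6
      corners = q ∷ p ∷ k₂ ∷ r ∷ k₃ ∷ p′ ∷ []

      distinct : Unique corners
      distinct =
        (apart dq dp c≢α ∷ q≢k₂ ∷ apart dq dr c≢γ ∷ q≢k₃ ∷ apart dq dp′ c≢β ∷ []) ∷
        (apart dp d₂ (≢-sym c≢α) ∷ apart dp dr (≢-sym γ≢α) ∷ apart dp d₃ (≢-sym c≢α) ∷ n ∷ []) ∷
        (apart d₂ dr c≢γ ∷ k₂≢k₃ ∷ apart d₂ dp′ c≢β ∷ []) ∷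
        (apart dr d₃ (≢-sym c≢γ) ∷ apart dr dp′ γ≢β ∷ []) ∷
        (apart d₃ dp′ c≢β ∷ []) ∷ [] ∷ []

      open Hexagon conn R.E-sym R._≟V_ no-fork (lookup corners) (lookup-injective distinct _ _)

      side : ∀ i → E H (lookup corners i) (lookup corners (next i))
      side 0F = qp
      side 1F = pk₂
      side 2F = k₂r
      side 3F = R.E-sym k₃r
      side 4F = R.E-sym p′k₃
      side 5F = R.E-sym qp′

      R″ : Root H G′
      R″ = relabel R′ (opposite side) (opposite-invol side) (opposite-E side)

    -- If q is not a tip in R′, it is α - o - β with o fat. Lightness leaves at most one path on
    -- each of the darts α → o and β → o, so p and p′ are centred at different ends of q, and the
    -- hexagon arises.
    arms⇒some-agree : ∀ {q p p′ q₀ p₀ p₀′} (R′ : Root H G′) → Arm R q p p′ → Arm R′ q₀ p₀ p₀′ →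
                      Σ (Root H G′) (Agree R)
    arms⇒some-agree {q} {p} {p′} R′ A A₀ with all-on-arm light′ R′ A₀ q
    ... | inj₁ (_ , _ , A′) = R′ , arms⇒agree R′ A A′
    ... | inj₂ (_ , t , arm {o} {β} (α , pq) (γ , pt) _ q≢t) =
      by (R′.neighbour pq (R.D⇒E cb bc)) (R′.neighbour pq (R.D⇒E cb bc′))
      where
      module R′ = RootProperties R′
      open Arm A
      γ≢α : γ ≢ α
      γ≢α refl = q≢t (R′.unique pq pt)
      γ≢β = R′.P⇒≢ pt
      oγ = adj-sym G′ (R′.P⇒adj pt)
      αoγ = R′.path (R′.P⇒adj pq) oγ (≢-sym γ≢α)
      q≢αoγ : q ≢ proj₁ αoγ
      q≢αoγ e = γ≢β (sym (R′.other-end pq (subst (R′.P α o γ) (sym e) (proj₂ αoγ))))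
      by : R′.D α o p ⊎ R′.D β o p → R′.D α o p′ ⊎ R′.D β o p′ → Σ (Root H G′) (Agree R)
      by (inj₁ d) (inj₁ d′) = ⊥-elim (p≢p′ (ThinPaths.light⇒thin R′ noIsolated (light′ R′)
                                (R′.P⇒Dˡ pq) (R′.P⇒Dˡ (proj₂ αoγ)) q≢αoγ d′ d′ d))
      by (inj₂ d) (inj₂ d′) = ⊥-elim (p≢p′ (ThinPaths.light⇒thin R′ noIsolated (light′ R′)
                                (R′.P⇒D pq) (R′.P⇒D pt) q≢t d′ d′ d))
      by (inj₁ d) (inj₂ d′) = hexagon⇒agree R′ A pq oγ γ≢α γ≢β d d′
      by (inj₂ d) (inj₁ d′) = hexagon⇒agree R′ A (R′.flip pq) oγ γ≢β γ≢α d d′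

  module _ {G G′} (light : Light noIsolated G) (light′ : Light noIsolated G′)
           (conflict : Conflict H G G′) (R : Root H G) (R′ : Root H G′) where
    not-both-fat : Fat R → ¬ Fat R′
    not-both-fat fat fat′ =
      fat⇒arm light R fat λ (_ , _ , _ , A) →
      fat⇒arm light′ R′ fat′ λ (_ , _ , _ , A′) →
      let (R″ , a) = arms⇒some-agree light light′ R R′ A A′ in conflict R R″ a

    not-both-lean : ¬ Fat R → ¬ ¬ Fat R′
    not-both-lean lean lean′ = noIsolated (proj₁ conn) λ (k , e) →
      conflict R R′ (thin⇒agree R R′ e (lean⇒thin light R lean _) (lean⇒thin light R lean k)
                                       (lean⇒thin light′ R′ lean′ _) (lean⇒thin light′ R′ lean′ k))

-- H with a single vertex.

module Single {H : RawGraph} (h : V H) (only : ∀ k → k ≡ h) where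
  module Spots {G : Graph} (conn : Connected (toRaw G)) (R : Root H G)
               {a b c : Vertex G} (p : Root.P R a b c h) where
    open RootProperties R

    path-is-h : ∀ {x y z} → x ~ y → y ~ z → x ≢ z → P x y z h
    path-is-h xy yz x≢z = let (k , r) = path xy yz x≢z in subst (P _ _ _) (only k) r

    spot : Fin 3 → Vertex G
    spot = lookup (a ∷ b ∷ c ∷ [])

    spot-injective : ∀ {i j} → spot i ≡ spot j → i ≡ j
    spot-injective = lookup-injective
      ((adj⇒≢ G (P⇒adj p) ∷ P⇒≢ p ∷ []) ∷ (adj⇒≢ G (P⇒adjʳ p) ∷ []) ∷ [] ∷ []) _ _

    neighbour-of-end : ∀ {a c} → P a b c h → ∀ {w} → a ~ w → w ≡ b
    neighbour-of-end r {w} aw = decidable-stable (w ≟ b) λ w≢b →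
      adj⇒≢ G (P⇒adj r) (center-unique (P⇒D (path-is-h (adj-sym G aw) (P⇒adj r) w≢b)) (P⇒D r))

    neighbour-of-centre : ∀ {w} → b ~ w → w ≡ a ⊎ w ≡ c
    neighbour-of-centre {w} bw with w ≟ a
    ... | yes w≡a = inj₁ w≡a
    ... | no w≢a  = inj₂ (sym (other-end p (path-is-h (P⇒adj p) bw (≢-sym w≢a))))

    spot-onto : ∀ v → ∃ λ i → spot i ≡ v
    spot-onto v = walk 0F (proj₂ conn a v)
      where
      walk : ∀ i {v} → Star _~_ (spot i) v → ∃ λ j → spot j ≡ v
      walk i ε = i , refl
      walk 0F (e ◅ es) with neighbour-of-end p e
      ... | refl = walk 1F es
      walk 1F (e ◅ es) with neighbour-of-centre e
      ... | inj₁ refl = walk 0F es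
      ... | inj₂ refl = walk 2F es
      walk 2F (e ◅ es) with neighbour-of-end (flip p) e
      ... | refl = walk 1F es

  module _ {G G′ : Graph} (conn : Connected (toRaw G)) (conn′ : Connected (toRaw G′))
           (R : Root H G) (R′ : Root H G′) where
    private
      module R  = RootProperties R
      module R′ = RootProperties R′

    module _ {a b c : Vertex G} {a′ b′ c′ : Vertex G′} (p : R.P a b c h) (p′ : R′.P a′ b′ c′ h) where
      private
        module S  = Spots conn R p
        module S′ = Spots conn′ R′ p′

      spots-adjacent : ∀ i j → Adj G (S.spot i) (S.spot j) → Adj G′ (S′.spot i) (S′.spot j)
      spots-adjacent 0F 0F e = ⊥-elim (adj⇒≢ G e refl)
      spots-adjacent 0F 1F _ = R′.P⇒adj p′
      spots-adjacent 0F 2F e = ⊥-elim (adj⇒≢ G (R.P⇒adjʳ p) (sym (S.neighbour-of-end p e)))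
      spots-adjacent 1F 0F _ = adj-sym G′ (R′.P⇒adj p′)
      spots-adjacent 1F 1F e = ⊥-elim (adj⇒≢ G e refl)
      spots-adjacent 1F 2F _ = R′.P⇒adjʳ p′
      spots-adjacent 2F 0F e = ⊥-elim (adj⇒≢ G (R.P⇒adj p) (S.neighbour-of-end (R.flip p) e))
      spots-adjacent 2F 1F _ = adj-sym G′ (R′.P⇒adjʳ p′)
      spots-adjacent 2F 2F e = ⊥-elim (adj⇒≢ G e refl)

  single⇒iso : ∀ {G G′} → Connected (toRaw G) → Connected (toRaw G′) → Root H G → Root H G′ →
               Iso (toRaw G) (toRaw G′)
  single⇒iso {G} {G′} conn conn′ R R′ = relation⇒iso {G} {G′}
    (λ v v′ → ∃ λ i → S.spot i ≡ v × S′.spot i ≡ v′)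
    (λ v → let (i , e) = S.spot-onto v in _ , i , e , refl)
    (λ v′ → let (i , e) = S′.spot-onto v′ in _ , i , refl , e)
    (λ (i , e , e′) (j , f , f′) → same S.spot S′.spot S.spot-injective i j e f e′ f′)
    (λ (i , e , e′) (j , f , f′) → same S′.spot S.spot S′.spot-injective i j e′ f′ e f)
    (λ { (i , refl , refl) (j , refl , refl) → spots-adjacent conn conn′ R R′ p p′ i j })
    (λ { (i , refl , refl) (j , refl , refl) → spots-adjacent conn′ conn R′ R p′ p i j })
    where
    p  = proj₂ (proj₂ (proj₂ (Root.view R h)))
    p′ = proj₂ (proj₂ (proj₂ (Root.view R′ h)))
    module S  = Spots conn R p
    module S′ = Spots conn′ R′ p′
    same : ∀ {A B : Set} (f : Fin 3 → A) (g : Fin 3 → B) → (∀ {i j} → f i ≡ f j → i ≡ j) →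
           ∀ i j {x y z} → f i ≡ x → f j ≡ x → g i ≡ y → g j ≡ z → y ≡ z
    same f g inj i j e e′ refl refl = cong g (inj (trans e (sym e′)))

-- Contradiction from three pairwise nonisomorphic roots.

theorem3p1 : ¬ (Σ Graph λ G₁ → Σ Graph λ G₂ → Σ Graph λ G₃ →
    (Connected (toRaw G₁) × Connected (toRaw G₂) × Connected (toRaw G₃)) ×
    (¬ Iso (toRaw G₁) (toRaw G₂) × ¬ Iso (toRaw G₁) (toRaw G₃) × ¬ Iso (toRaw G₂) (toRaw G₃)) ×
    (Iso (P3Graph G₁) (P3Graph G₂) × Iso (P3Graph G₁) (P3Graph G₃) × Iso (P3Graph G₂) (P3Graph G₃)) ×
    (Connected (P3Graph G₁) × Connected (P3Graph G₂) × Connected (P3Graph G₃)))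
theorem3p1 (G₁ , G₂ , G₃ , (conn₁ , conn₂ , conn₃) , (n₁₂ , n₁₃ , n₂₃) ,
            ((f₂ , e₂) , (f₃ , e₃) , _) , (conn , _)) =
  -- Each root is fat or lean, and neither class can hold two of the three.
  not-both-lean l₁ l₂ c₁₂ R₁ R₂ lean₁ λ fat₂ →
  not-both-lean l₁ l₃ c₁₃ R₁ R₃ lean₁ λ fat₃ →
  not-both-fat l₂ l₃ c₂₃ R₂ R₃ fat₂ fat₃
  where
  H : RawGraph
  H = P3Graph G₁

  R₁ : Root H G₁
  R₁ = root G₁ (↔-id _) (λ _ _ → mk⇔ id id)
  R₂ : Root H G₂
  R₂ = root G₂ f₂ e₂
  R₃ : Root H G₃
  R₃ = root G₃ f₃ e₃

  -- An isolated vertex of the connected graph H is all of H, and then G₁ and G₂ are both a path on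
  -- three vertices.
  noIsolated : NoIsolated H
  noIsolated h isolated = n₁₂ (Single.single⇒iso h (λ k → only (proj₂ conn h k)) conn₁ conn₂ R₁ R₂)
    where
    only : ∀ {k} → Star (E H) h k → k ≡ h
    only ε       = refl
    only (e ◅ _) = ⊥-elim (isolated (_ , e))

  conflict : ∀ {G G′} → Connected (toRaw G) → Connected (toRaw G′) →
             ¬ Iso (toRaw G) (toRaw G′) → Conflict H G G′
  conflict c c′ n R R′ a = agree⇒iso noIsolated (proj₁ conn) c c′ a n

  c₁₂ : Conflict H G₁ G₂
  c₁₂ = conflict conn₁ conn₂ n₁₂
  c₁₃ : Conflict H G₁ G₃
  c₁₃ = conflict conn₁ conn₃ n₁₃
  c₂₃ : Conflict H G₂ G₃
  c₂₃ = conflict conn₂ conn₃ n₂₃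

  l₁ : Light noIsolated G₁
  l₁ R = Heavy.no-heavy noIsolated R R₂ R₃ c₁₂ c₁₃ c₂₃
  l₂ : Light noIsolated G₂
  l₂ R = Heavy.no-heavy noIsolated R R₁ R₃ (conflict-sym c₁₂) c₂₃ c₁₃
  l₃ : Light noIsolated G₃
  l₃ R = Heavy.no-heavy noIsolated R R₁ R₂ (conflict-sym c₁₃) (conflict-sym c₂₃) c₁₂

  open Arms conn noIsolated (no-fork noIsolated R₁ R₂ R₃ l₁ l₂ l₃ c₁₂ c₁₃ c₂₃)

  lean₁ : ¬ Fat R₁
  lean₁ fat₁ = not-both-lean l₂ l₃ c₂₃ R₂ R₃ (not-both-fat l₁ l₂ c₁₂ R₁ R₂ fat₁)
                                             (not-both-fat l₁ l₃ c₁₃ R₁ R₃ fat₁)
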